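{- Let $0<q<1$, and for integers $n,s\ge 0$ define \[ f(n,s):=\frac{1}{c(q)}\int_{ -\nu}^{\nu}x^{2n}H_s(x,q)^2\,w_G(x)\,d_qx . \] Then for all integers $n\ge0$ and $s\ge2$, \[ f(n,s)=f(n+1,s-1)-2\sum_{l=0}^{s-2}(-1)^{s-l}\,\frac{q^{\binom{s-1}{2}}[s-1]_q!}{q^{\binom{l}{2}}[l]_q!}\,f(n+1,l)+q^{2(s-2)}[s-1]_q^2\,f(n,s-2), \] with $f(n,0)=[2n-1]_q!!$ and $f(n,1)=[2n+1]_q!!$ for all $n\ge0$.
   Context: For an integer $m\ge0$, $[m]_q=\frac{1-q^m}{1-q}$, $[m]_q!=\prod_{i=1}^m[i]_q$, and $[2m-1]_q!!=[2m-1]_q[2m-3]_q\cdots[3]_q[1]_q$ (equal to $1$ for $m=0$). The $q$-Hermite polynomials $H_n(x,q)$ are defined by $H_0=1$, $H_1=x$, and $H_{n+1}(x,q)=xH_n(x,q)-q^{n-1}[n]_qH_{n-1}(x,q)$ for $n\ge1$. The Gaussian $q$-distribution is $w_G(x)=E_{q^2}^{ -q^2x^2/[2]_q}$, where $E_q^x=\sum_{m=0}^\infty q^{\binom m2}\frac{x^m}{[m]_q!}$ (and $E_{q^2}$ is obtained by replacing $q$ by $q^2$); explicitly, $w_G(x)=\sum_{m=0}^{\infty}\frac{q^{m(m+1)}(q-1)^m}{\prod_{i=0}^{m-1}(1-q^{2i+2})}x^{2m}$. The Jackson $q$-integral is $\int_0^b f(x)\,d_qx=(1-q)\,b\sum_{m=0}^\infty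 q^m f(q^m b)$ and $\int_a^b f\,d_qx=\int_0^b f\,d_qx-\int_0^a f\,d_qx$. Moreover $\nu=\frac{1}{\sqrt{1-q}}$ and \[ c(q)=\int_{ -\nu}^{\nu}w_G(x)\,d_qx=2\sqrt{1-q}\,\sum_{m=0}^{\infty}\frac{(-1)^m q^{m(m+1)}}{(1-q^{2m+1})\prod_{i=0}^{m-1}(1-q^{2i+2})}. \] -}

module Defs where

open import Level using (Level; _⊔_) renaming (suc to lsuc)
open import Algebra.Apartness.Bundles using (HeytingField; HeytingCommutativeRing)
import Algebra.Apartness.Properties.HeytingCommutativeRing as HCRProperties
open import Algebra.Bundles using (CommutativeRing; RawRing)
import Algebra.Properties.Monoid.Mult as MonoidMult
import Algebra.Properties.Monoid.Sum as MonoidSum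
import Algebra.Properties.Semiring.Exp as SemiringExp
import Algebra.Properties.CommutativeSemiring.Exp as CommutativeSemiringExp
import Algebra.Properties.Semiring.Mult.TCOptimised as SemiringMultTC
import Algebra.Properties.Ring as RingProperties
import Algebra.Solver.Ring as RingSolver
open import Algebra.Solver.Ring.AlmostCommutativeRing using (AlmostCommutativeRing; fromCommutativeRing; _-Raw-AlmostCommutative⟶_)
open import Data.Empty using (⊥-elim)
open import Data.Fin.Base using (toℕ)
open import Data.Integer.Base as ℤ using (ℤ)
import Data.Integer.Properties as ℤₚ
open import Data.Bool.Base using (T)
open import Data.Maybe using (Maybe; just; nothing; is-just; to-witness-T)
import Data.Vec.Base as Vec
open import Data.Vec.N-ary using (N-ary; _$ⁿ_; Eq; curryⁿ; curryⁿ-cong)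
open import Data.Nat.Base as ℕ using (ℕ; zero; suc; _∸_)
open import Data.Nat.Combinatorics using (_C_; nC1≡n; nCk+nC[k+1]≡[n+1]C[k+1])
import Data.Nat.Properties as ℕₚ
open import Data.Product.Base using (∃; _×_; _,_; proj₁; proj₂)
open import Data.Sum.Base using (_⊎_; inj₁; inj₂)
open import Relation.Binary.Core using (Rel)
open import Relation.Binary.Structures using (IsStrictPartialOrder)
import Relation.Binary.Reasoning.Setoid as SetoidReasoning
import Relation.Binary.PropositionalEquality.Core as ≡
open import Relation.Nullary.Decidable.Core using (yes; no)
open import Relation.Nullary.Negation.Core using (¬_)

-- The library has no real numbers, so ℝ is axiomatised as a Cauchy-complete
-- Archimedean ordered field, which determines it up to unique isomorphism.
-- The axioms are those satisfied by the constructive (Cauchy or Bishop) reals: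
-- _<_ is primitive, _≤_ is the negation of the converse of _<_, and only
-- elements apart from 0 are inverted.

record RealField c ℓ₁ ℓ₂ ℓ₃ : Set (lsuc (c ⊔ ℓ₁ ⊔ ℓ₂ ⊔ ℓ₃)) where
  infix 4 _<_ _≤_ _⟶_
  infix 3 ∣_∣<_
  field
    heytingField : HeytingField c ℓ₁ ℓ₂

  open HeytingField heytingField public

  field
    _<_                  : Rel Carrier ℓ₃
    isStrictPartialOrder : IsStrictPartialOrder _≈_ _<_
    #⇒<⊎>                : ∀ {x y} → x # y → x < y ⊎ y < x
    <⇒#                  : ∀ {x y} → x < y → x # y
    +-monoʳ-<            : ∀ z {x y} → x < y → z + x < z + y
    *-pos                : ∀ {x y} → 0# < x → 0# < y → 0# < x * y

  _≤_ : Rel Carrier ℓ₃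
  x ≤ y = ¬ (y < x)

  ∣_∣<_ : Rel Carrier ℓ₃
  ∣ x ∣< ε = - ε < x × x < ε

  _⟶_ : (ℕ → Carrier) → Carrier → Set (c ⊔ ℓ₃)
  u ⟶ L = ∀ ε → 0# < ε → ∃ λ N → ∀ n → N ℕ.≤ n → ∣ u n - L ∣< ε

  Cauchy : (ℕ → Carrier) → Set (c ⊔ ℓ₃)
  Cauchy u = ∀ ε → 0# < ε →
    ∃ λ N → ∀ m n → N ℕ.≤ m → N ℕ.≤ n → ∣ u m - u n ∣< ε

  commutativeRing : CommutativeRing c ℓ₁
  commutativeRing = HeytingCommutativeRing.commutativeRing heytingCommutativeRing

  open CommutativeRing commutativeRing public
    using (ring; semiring; commutativeSemiring; +-monoid)
  open MonoidMult +-monoid public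
    using () renaming (_×_ to _·_)

  field
    archimedean : ∀ x → ∃ λ n → x < n · 1#
    complete    : ∀ u → Cauchy u → ∃ λ L → u ⟶ L

module OrderedField {c ℓ₁ ℓ₂ ℓ₃ : Level} (ℝ : RealField c ℓ₁ ℓ₂ ℓ₃) where
  open RealField ℝ public
  open SemiringExp semiring public using (_^_; ^-congˡ; ^-homo-*; ^-assocʳ)
  open CommutativeSemiringExp commutativeSemiring public using (^-distrib-*)
  open HCRProperties heytingCommutativeRing public
    using (1#0; x#0y#0→xy#0; invertibleˡ⇒#; x-0≈x)
  open IsStrictPartialOrder isStrictPartialOrder public
    using () renaming (trans to <-trans; irrefl to <-irrefl; asym to <-asym; <-respˡ-≈ to <-respˡ; <-respʳ-≈ to <-respʳ)
  private
    module M = SemiringMultTC semiring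
    module RP = RingProperties ring
    ACR : AlmostCommutativeRing c ℓ₁
    ACR = fromCommutativeRing commutativeRing

  open SetoidReasoning setoid public

  private
    emb : ℕ → Carrier
    emb n = n M.× 1#

    ⟦_⟧ℤ : ℤ → Carrier
    ⟦ ℤ.+ n ⟧ℤ      = emb n
    ⟦ ℤ.-[1+ n ] ⟧ℤ = - emb (suc n)

    neg0 : - 0# ≈ 0#
    neg0 = RP.-0#≈0#

    cancel : ∀ x a b → (x + a) - (x + b) ≈ a - b
    cancel x a b = begin
      (x + a) - (x + b)       ≈⟨ +-cong (+-comm x a) (sym (RP.-‿+-comm x b)) ⟩
      (a + x) + (- x + - b)   ≈⟨ +-assoc a x _ ⟩
      a + (x + (- x + - b))   ≈⟨ +-congˡ (sym (+-assoc x (- x) (- b))) ⟩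
      a + ((x - x) + - b)     ≈⟨ +-congˡ (+-congʳ (-‿inverseʳ x)) ⟩
      a + (0# + - b)          ≈⟨ +-congˡ (+-identityˡ _) ⟩
      a - b                   ∎

    ⊖-homo : ∀ m n → ⟦ m ℤ.⊖ n ⟧ℤ ≈ emb m - emb n
    ⊖-homo m zero = sym (trans (+-congˡ neg0) (+-identityʳ _))
    ⊖-homo zero (suc n) = sym (+-identityˡ _)
    ⊖-homo (suc m) (suc n) = begin
      ⟦ suc m ℤ.⊖ suc n ⟧ℤ             ≡⟨ ≡.cong ⟦_⟧ℤ (ℤₚ.[1+m]⊖[1+n]≡m⊖n m n) ⟩
      ⟦ m ℤ.⊖ n ⟧ℤ                     ≈⟨ ⊖-homo m n ⟩
      emb m - emb n                    ≈⟨ cancel 1# (emb m) (emb n) ⟨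
      (1# + emb m) - (1# + emb n)      ≈⟨ +-cong (M.1+× m 1#) (-‿cong (M.1+× n 1#)) ⟨
      emb (suc m) - emb (suc n)        ∎

    emb-+ : ∀ m n → emb (m ℕ.+ n) ≈ emb m + emb n
    emb-+ m n = M.×-homo-+ 1# m n

    emb-* : ∀ m n → emb (m ℕ.* n) ≈ emb m * emb n
    emb-* = M.×1-homo-*

    ℤ-+ : ∀ i j → ⟦ i ℤ.+ j ⟧ℤ ≈ ⟦ i ⟧ℤ + ⟦ j ⟧ℤ
    ℤ-+ (ℤ.+ m) (ℤ.+ n) = emb-+ m n
    ℤ-+ (ℤ.+ m) ℤ.-[1+ n ] = ⊖-homo m (suc n)
    ℤ-+ ℤ.-[1+ m ] (ℤ.+ n) = trans (⊖-homo n (suc m)) (+-comm _ _)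
    ℤ-+ ℤ.-[1+ m ] ℤ.-[1+ n ] = begin
      - emb (suc (suc (m ℕ.+ n)))     ≡⟨ ≡.cong (λ k → - emb (suc k)) (ℕₚ.+-suc m n) ⟨
      - emb (suc m ℕ.+ suc n)         ≈⟨ -‿cong (emb-+ (suc m) (suc n)) ⟩
      - (emb (suc m) + emb (suc n))   ≈⟨ RP.-‿+-comm _ _ ⟨
      - emb (suc m) - emb (suc n)     ∎

    ℤ-neg : ∀ i → ⟦ ℤ.- i ⟧ℤ ≈ - ⟦ i ⟧ℤ
    ℤ-neg (ℤ.+ zero)    = sym neg0
    ℤ-neg (ℤ.+ suc n)   = refl
    ℤ-neg ℤ.-[1+ n ]    = sym (RP.-‿involutive _)

    ℤ-* : ∀ i j → ⟦ i ℤ.* j ⟧ℤ ≈ ⟦ i ⟧ℤ * ⟦ j ⟧ℤ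
    ℤ-* (ℤ.+ m) (ℤ.+ n) = trans (reflexive (≡.cong ⟦_⟧ℤ (≡.sym (ℤₚ.pos-* m n)))) (emb-* m n)
    ℤ-* (ℤ.+ m) ℤ.-[1+ n ] = begin
      ⟦ ℤ.+ m ℤ.* (ℤ.- ℤ.+ suc n) ⟧ℤ   ≡⟨ ≡.cong ⟦_⟧ℤ (ℤₚ.neg-distribʳ-* (ℤ.+ m) (ℤ.+ suc n)) ⟨
      ⟦ ℤ.- (ℤ.+ m ℤ.* ℤ.+ suc n) ⟧ℤ   ≈⟨ ℤ-neg (ℤ.+ m ℤ.* ℤ.+ suc n) ⟩
      - ⟦ ℤ.+ m ℤ.* ℤ.+ suc n ⟧ℤ       ≈⟨ -‿cong (ℤ-* (ℤ.+ m) (ℤ.+ suc n)) ⟩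
      - (emb m * emb (suc n))          ≈⟨ RP.-‿distribʳ-* _ _ ⟩
      emb m * - emb (suc n)            ∎
    ℤ-* ℤ.-[1+ m ] (ℤ.+ n) = begin
      ⟦ (ℤ.- ℤ.+ suc m) ℤ.* ℤ.+ n ⟧ℤ   ≡⟨ ≡.cong ⟦_⟧ℤ (ℤₚ.neg-distribˡ-* (ℤ.+ suc m) (ℤ.+ n)) ⟨
      ⟦ ℤ.- (ℤ.+ suc m ℤ.* ℤ.+ n) ⟧ℤ   ≈⟨ ℤ-neg (ℤ.+ suc m ℤ.* ℤ.+ n) ⟩
      - ⟦ ℤ.+ suc m ℤ.* ℤ.+ n ⟧ℤ       ≈⟨ -‿cong (ℤ-* (ℤ.+ suc m) (ℤ.+ n)) ⟩
      - (emb (suc m) * emb n)          ≈⟨ RP.-‿distribˡ-* _ _ ⟩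
      - emb (suc m) * emb n            ∎
    ℤ-* ℤ.-[1+ m ] ℤ.-[1+ n ] = begin
      emb (suc m ℕ.* suc n)            ≈⟨ emb-* (suc m) (suc n) ⟩
      emb (suc m) * emb (suc n)        ≈⟨ RP.-‿involutive _ ⟨
      - - (emb (suc m) * emb (suc n))  ≈⟨ -‿cong (RP.-‿distribʳ-* _ _) ⟩
      - (emb (suc m) * - emb (suc n))  ≈⟨ RP.-‿distribˡ-* _ _ ⟩
      - emb (suc m) * - emb (suc n)    ∎

    ℤ-rawRing : RawRing _ _
    ℤ-rawRing = ℤ.+-*-rawRing

    morphism : ℤ-rawRing -Raw-AlmostCommutative⟶ ACR
    morphism = record
      { ⟦_⟧    = ⟦_⟧ℤ
      ; +-homo = ℤ-+
      ; *-homo = ℤ-*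
      ; -‿homo = ℤ-neg
      ; 0-homo = refl
      ; 1-homo = refl
      }

    coeff≟ : ∀ i j → Maybe (⟦ i ⟧ℤ ≈ ⟦ j ⟧ℤ)
    coeff≟ i j with i ℤₚ.≟ j
    ... | yes i≡j = just (reflexive (≡.cong ⟦_⟧ℤ i≡j))
    ... | no  _   = nothing

  module Solver = RingSolver ℤ-rawRing ACR morphism coeff≟
  open Solver public using (Polynomial; con; _:+_; _:*_; _:-_; :-_; _:=_)

  :0 :1 : ∀ {n} → Polynomial n
  :0 = con (ℤ.+ 0)
  :1 = con (ℤ.+ 1)

  -- Unlike the solver of the library this one compares the normal forms
  -- as data, which is much cheaper than comparing what they denote.
  abstract
    solve : ∀ n (f : N-ary n (Polynomial n) (Polynomial n × Polynomial n)) →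
            let e = f $ⁿ Vec.map Solver.var (Vec.allFin n)
                e₁ = proj₁ e
                e₂ = proj₂ e
            in {T (is-just (Solver.normalise e₁ Solver.≟N Solver.normalise e₂))} →
               Eq n _≈_ (curryⁿ (Solver.⟦_⟧ e₁)) (curryⁿ (Solver.⟦_⟧ e₂))
    solve n f {t} = curryⁿ-cong _≈_ (Solver.⟦_⟧ e₁) (Solver.⟦_⟧ e₂) λ ρ →
      Solver.prove ρ e₁ e₂ (Solver.⟦ to-witness-T (Solver.normalise e₁ Solver.≟N Solver.normalise e₂) t ⟧N-cong ρ)
      where
      e₁ e₂ : Polynomial n
      e₁ = proj₁ (f $ⁿ Vec.map Solver.var (Vec.allFin n))
      e₂ = proj₂ (f $ⁿ Vec.map Solver.var (Vec.allFin n))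

  <-resp : ∀ {a b x y} → a ≈ b → x ≈ y → a < x → b < y
  <-resp p r h = <-respʳ r (<-respˡ p h)

  lt : ∀ {x y z} → 0# < z → y - x ≈ z → x < y
  lt {x} {y} {z} h e = <-resp (+-identityʳ x)
    (trans (+-congˡ (sym e)) (solve 2 (λ x y → x :+ (y :- x) := y) x y))
    (+-monoʳ-< x h)

  0<- : ∀ {x y} → x < y → 0# < y - x
  0<- {x} {y} h = <-resp (-‿inverseˡ x) (+-comm (- x) y) (+-monoʳ-< (- x) h)

  ≤-resp : ∀ {a b x y} → a ≈ b → x ≈ y → a ≤ x → b ≤ y
  ≤-resp p r h g = h (<-resp (sym r) (sym p) g)

  le : ∀ {x y z} → 0# ≤ z → y - x ≈ z → x ≤ y
  le {x} {y} {z} h e y<x = h (lt (0<- y<x)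
    (trans (+-congˡ (-‿cong (sym e))) (solve 2 (λ x y → :0 :- (y :- x) := x :- y) x y)))

  0≤- : ∀ {x y} → x ≤ y → 0# ≤ y - x
  0≤- {x} {y} h g = h (lt (0<- g) (solve 2 (λ x y → x :- y := :0 :- (y :- x)) x y))

  <-cotrans : ∀ {x y} → x < y → ∀ z → x < z ⊎ z < y
  <-cotrans x<y z with #-cotrans (<⇒# x<y) z
  ... | inj₁ x#z with #⇒<⊎> x#z
  ...   | inj₁ x<z = inj₁ x<z
  ...   | inj₂ z<x = inj₂ (<-trans z<x x<y)
  <-cotrans x<y z | inj₂ z#y with #⇒<⊎> z#y
  ...   | inj₁ z<y = inj₂ z<y
  ...   | inj₂ y<z = inj₁ (<-trans x<y y<z)

  ≤-refl : ∀ {x} → x ≤ x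
  ≤-refl = <-irrefl refl

  ≤-reflexive : ∀ {x y} → x ≈ y → x ≤ y
  ≤-reflexive e = <-irrefl (sym e)

  <⇒≤ : ∀ {x y} → x < y → x ≤ y
  <⇒≤ = <-asym

  ≤-trans : ∀ {x y z} → x ≤ y → y ≤ z → x ≤ z
  ≤-trans {x} {y} {z} p r z<x with <-cotrans z<x y
  ... | inj₁ z<y = r z<y
  ... | inj₂ y<x = p y<x

  <-≤-trans : ∀ {x y z} → x < y → y ≤ z → x < z
  <-≤-trans {z = z} p r with <-cotrans p z
  ... | inj₁ x<z = x<z
  ... | inj₂ z<y = ⊥-elim (r z<y)

  ≤-<-trans : ∀ {x y z} → x ≤ y → y < z → x < z
  ≤-<-trans {x = x} p r with <-cotrans r x
  ... | inj₁ y<x = ⊥-elim (p y<x)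
  ... | inj₂ x<z = x<z

  ≤-antisym : ∀ {x y} → x ≤ y → y ≤ x → x ≈ y
  ≤-antisym {x} {y} p r = proj₁ (tight x y) apart
    where
    apart : ¬ (x # y)
    apart h with #⇒<⊎> h
    ... | inj₁ x<y = r x<y
    ... | inj₂ y<x = p y<x

  0<⇒#0 : ∀ {x} → 0# < x → x # 0#
  0<⇒#0 h = #-sym (<⇒# h)

  0<1 : 0# < 1#
  0<1 with #⇒<⊎> 1#0
  ... | inj₂ h = h
  ... | inj₁ h = <-resp refl (solve 0 ((:0 :- :1) :* (:0 :- :1) := :1)) (*-pos (0<- h) (0<- h))

  0≤1 : 0# ≤ 1#
  0≤1 = <⇒≤ 0<1

  +-nonneg : ∀ {x y} → 0# ≤ x → 0# ≤ y → 0# ≤ x + y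
  +-nonneg {x} {y} p r h with <-cotrans h x
  ... | inj₁ a = r (lt (0<- a) (solve 2 (λ x y → :0 :- y := x :- (x :+ y)) x y))
  ... | inj₂ a = p a

  +-nonneg-pos : ∀ {x y} → 0# ≤ x → 0# < y → 0# < x + y
  +-nonneg-pos {x} {y} p r with <-cotrans r (x + y)
  ... | inj₁ a = a
  ... | inj₂ a = ⊥-elim (p (lt (0<- a) (solve 2 (λ x y → :0 :- x := y :- (x :+ y)) x y)))

  +-pos : ∀ {x y} → 0# < x → 0# < y → 0# < x + y
  +-pos p r = +-nonneg-pos (<⇒≤ p) r

  *-neg : ∀ {x y} → x < 0# → 0# < y → x * y < 0#
  *-neg {x} {y} p r = lt (*-pos (0<- p) r) (solve 2 (λ x y → :0 :- x :* y := (:0 :- x) :* y) x y)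

  *-nonneg : ∀ {x y} → 0# ≤ x → 0# ≤ y → 0# ≤ x * y
  *-nonneg {x} {y} p r h = <-asym h (*-pos (positive p x#0) (positive r y#0))
    where
    positive : ∀ {z} → 0# ≤ z → z # 0# → 0# < z
    positive q z#0 with #⇒<⊎> z#0
    ... | inj₁ z<0 = ⊥-elim (q z<0)
    ... | inj₂ 0<z = 0<z
    xy⁻¹ = #⇒invertible (<⇒# h)
    i = proj₁ xy⁻¹
    x#0 : x # 0#
    x#0 = invertibleˡ⇒# (i * y , trans (solve 3 (λ x y i → i :* y :* (x :- :0) := i :* (x :* y :- :0)) x y i) (proj₁ (proj₂ xy⁻¹)))
    y#0 : y # 0#
    y#0 = invertibleˡ⇒# (i * x , trans (solve 3 (λ x y i → i :* x :* (y :- :0) := i :* (x :* y :- :0)) x y i) (proj₁ (proj₂ xy⁻¹)))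

  0≤-half : ∀ {x} → 0# ≤ x + x → 0# ≤ x
  0≤-half {x} p h = p (lt (+-pos (0<- h) (0<- h)) (solve 1 (λ x → :0 :- (x :+ x) := (:0 :- x) :+ (:0 :- x)) x))

  square-nonneg : ∀ x → 0# ≤ x * x
  square-nonneg x h with <⇒# h
  ... | xx#0 with #⇒<⊎> x#0
    where
    xx⁻¹ = #⇒invertible xx#0
    x#0 : x # 0#
    x#0 = invertibleˡ⇒# (proj₁ xx⁻¹ * x , trans (solve 2 (λ x i → i :* x :* (x :- :0) := i :* (x :* x :- :0)) x (proj₁ xx⁻¹)) (proj₁ (proj₂ xx⁻¹)))
  ...   | inj₂ a = <-asym h (*-pos a a)
  ...   | inj₁ a = <-asym h (<-resp refl (solve 1 (λ x → (:0 :- x) :* (:0 :- x) := x :* x) x) (*-pos (0<- a) (0<- a)))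

  infixl 7 _÷_[_]
  _÷_[_] : ∀ x y → y # 0# → Carrier
  x ÷ y [ y#0 ] = x * proj₁ (#⇒invertible y#0)

  abstract
    ÷-* : ∀ x y (h : y # 0#) → x ÷ y [ h ] * y ≈ x
    ÷-* x y h = begin
      x * i * y           ≈⟨ solve 3 (λ x i y → x :* i :* y := x :* (i :* (y :- :0))) x i y ⟩
      x * (i * (y - 0#))  ≈⟨ *-congˡ (proj₁ (proj₂ (#⇒invertible h))) ⟩
      x * 1#              ≈⟨ *-identityʳ x ⟩
      x                   ∎
      where
      i : Carrier
      i = proj₁ (#⇒invertible h)

    *-cancelʳ : ∀ {x y} z → z # 0# → x * z ≈ y * z → x ≈ y
    *-cancelʳ {x} {y} z h e = begin
      x                   ≈⟨ ÷-* x z h ⟨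
      x * i * z           ≈⟨ solve 3 (λ x i z → x :* i :* z := x :* z :* i) x i z ⟩
      x * z * i           ≈⟨ *-congʳ e ⟩
      y * z * i           ≈⟨ solve 3 (λ x i z → x :* i :* z := x :* z :* i) y z i ⟩
      y * i * z           ≈⟨ ÷-* y z h ⟩
      y                   ∎
      where
      i : Carrier
      i = proj₁ (#⇒invertible h)

    ÷-pos : ∀ {x y} (h : y # 0#) → 0# < x → 0# < y → 0# < x ÷ y [ h ]
    ÷-pos {x} {y} h 0<x 0<y = case (#⇒<⊎> d#0)
      where
      d#0 : (x ÷ y [ h ]) # 0#
      d#0 = x#0y#0→xy#0 (0<⇒#0 0<x) (invertibleˡ⇒# (y , trans (solve 2 (λ i y → y :* (i :- :0) := :1 :* i :* y) (proj₁ (#⇒invertible h)) y) (÷-* 1# y h)))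
      case : x ÷ y [ h ] < 0# ⊎ 0# < x ÷ y [ h ] → 0# < x ÷ y [ h ]
      case (inj₂ a) = a
      case (inj₁ a) = ⊥-elim (<-asym 0<x (<-respˡ (÷-* x y h) (*-neg a 0<y)))

  *-monoˡ-≤ : ∀ {x y z} → 0# ≤ z → x ≤ y → z * x ≤ z * y
  *-monoˡ-≤ {x} {y} {z} p h = le (*-nonneg p (0≤- h)) (solve 3 (λ x y z → z :* y :- z :* x := z :* (y :- x)) x y z)

  *-monoʳ-≤ : ∀ {x y z} → 0# ≤ z → x ≤ y → x * z ≤ y * z
  *-monoʳ-≤ {x} {y} {z} p h = le (*-nonneg (0≤- h) p) (solve 3 (λ x y z → y :* z :- x :* z := (y :- x) :* z) x y z)

  *-monoʳ-< : ∀ {x y z} → 0# < z → x < y → x * z < y * z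
  *-monoʳ-< {x} {y} {z} p h = lt (*-pos (0<- h) p) (solve 3 (λ x y z → y :* z :- x :* z := (y :- x) :* z) x y z)

  +-mono-≤ : ∀ {x y u v} → x ≤ y → u ≤ v → x + u ≤ y + v
  +-mono-≤ {x} {y} {u} {v} p r = le (+-nonneg (0≤- p) (0≤- r))
    (solve 4 (λ x y u v → y :+ v :- (x :+ u) := (y :- x) :+ (v :- u)) x y u v)

  *-mono-≤ : ∀ {x y u v} → 0# ≤ x → 0# ≤ v → x ≤ y → u ≤ v → x * u ≤ y * v
  *-mono-≤ p r h g = ≤-trans (*-monoˡ-≤ p g) (*-monoʳ-≤ r h)

  ^-pos : ∀ {x} → 0# < x → ∀ n → 0# < x ^ n
  ^-pos h zero    = 0<1
  ^-pos h (suc n) = *-pos h (^-pos h n)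

  ^≤1 : ∀ {x} → 0# ≤ x → x ≤ 1# → ∀ n → x ^ n ≤ 1#
  ^≤1 p h zero    = ≤-refl
  ^≤1 p h (suc n) = ≤-resp refl (*-identityˡ 1#) (*-mono-≤ p 0≤1 h (^≤1 p h n))

  ^<1 : ∀ {x} → 0# < x → x < 1# → ∀ n → x ^ suc n < 1#
  ^<1 {x} p h n = ≤-<-trans (≤-resp refl (*-identityʳ x) (*-monoˡ-≤ (<⇒≤ p) (^≤1 (<⇒≤ p) (<⇒≤ h) n))) h

  ^-anti : ∀ {x} → 0# < x → x ≤ 1# → ∀ m k → x ^ (m ℕ.+ k) ≤ x ^ m
  ^-anti {x} p h m k = ≤-resp (sym (^-homo-* x m k)) (*-identityʳ _)
    (*-monoˡ-≤ (<⇒≤ (^-pos p m)) (^≤1 (<⇒≤ p) h k))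

  infix 3 ∣_∣≤_
  ∣_∣≤_ : Carrier → Carrier → Set ℓ₃
  ∣ x ∣≤ b = (0# ≤ b + x) × (0# ≤ b - x)

  ∣∣-resp : ∀ {x y a b} → x ≈ y → a ≈ b → ∣ x ∣≤ a → ∣ y ∣≤ b
  ∣∣-resp e f (p , r) = ≤-resp refl (+-cong f e) p , ≤-resp refl (+-cong f (-‿cong e)) r

  ∣∣-bound : ∀ {x b} → ∣ x ∣≤ b → 0# ≤ b
  ∣∣-bound {x} {b} (p , r) = 0≤-half (≤-resp refl (solve 2 (λ x b → (b :+ x) :+ (b :- x) := b :+ b) x b) (+-nonneg p r))

  ∣∣-≤ : ∀ {x b} → ∣ x ∣≤ b → x ≤ b
  ∣∣-≤ (p , r) = le r refl

  ∣∣-nonneg : ∀ {x} → 0# ≤ x → ∣ x ∣≤ x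
  ∣∣-nonneg {x} h = +-nonneg h h , ≤-reflexive (sym (-‿inverseʳ x))

  ∣∣-mono : ∀ {x a b} → a ≤ b → ∣ x ∣≤ a → ∣ x ∣≤ b
  ∣∣-mono {x} {a} {b} h (p , r) =
    ≤-resp refl (solve 3 (λ x a b → (b :- a) :+ (a :+ x) := b :+ x) x a b) (+-nonneg (0≤- h) p) ,
    ≤-resp refl (solve 3 (λ x a b → (b :- a) :+ (a :- x) := b :- x) x a b) (+-nonneg (0≤- h) r)

  ∣∣-neg : ∀ {x b} → ∣ x ∣≤ b → ∣ - x ∣≤ b
  ∣∣-neg {x} {b} (p , r) = r , ≤-resp refl (solve 2 (λ x b → b :+ x := b :- :- x) x b) p

  ∣∣-+ : ∀ {x y a b} → ∣ x ∣≤ a → ∣ y ∣≤ b → ∣ x + y ∣≤ a + b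
  ∣∣-+ {x} {y} {a} {b} (p , r) (s , t) =
    ≤-resp refl (solve 4 (λ x y a b → (a :+ x) :+ (b :+ y) := (a :+ b) :+ (x :+ y)) x y a b) (+-nonneg p s) ,
    ≤-resp refl (solve 4 (λ x y a b → (a :- x) :+ (b :- y) := (a :+ b) :- (x :+ y)) x y a b) (+-nonneg r t)

  ∣∣-* : ∀ {x y a b} → ∣ x ∣≤ a → ∣ y ∣≤ b → ∣ x * y ∣≤ a * b
  ∣∣-* {x} {y} {a} {b} (p , r) (s , t) =
    0≤-half (≤-resp refl (solve 4 (λ x y a b → (a :+ x) :* (b :+ y) :+ (a :- x) :* (b :- y) := (a :* b :+ x :* y) :+ (a :* b :+ x :* y)) x y a b)
      (+-nonneg (*-nonneg p s) (*-nonneg r t))) ,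
    0≤-half (≤-resp refl (solve 4 (λ x y a b → (a :+ x) :* (b :- y) :+ (a :- x) :* (b :+ y) := (a :* b :- x :* y) :+ (a :* b :- x :* y)) x y a b)
      (+-nonneg (*-nonneg p t) (*-nonneg r s)))

  ∣∣-^ : ∀ {x a} → ∣ x ∣≤ a → ∀ n → ∣ x ^ n ∣≤ a ^ n
  ∣∣-^ h zero    = ∣∣-nonneg 0≤1
  ∣∣-^ h (suc n) = ∣∣-* h (∣∣-^ h n)

  ∣∣<⇒≤ : ∀ {x b} → ∣ x ∣< b → ∣ x ∣≤ b
  ∣∣<⇒≤ {x} {b} (p , r) =
    ≤-resp refl (solve 2 (λ x b → x :- :- b := b :+ x) x b) (0≤- (<⇒≤ p)) , 0≤- (<⇒≤ r)

  ∣∣≤⇒< : ∀ {x a b} → a < b → ∣ x ∣≤ a → ∣ x ∣< b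
  ∣∣≤⇒< {x} {a} {b} h (p , r) =
    lt (+-nonneg-pos p (0<- h)) (solve 3 (λ x a b → x :- :- b := (a :+ x) :+ (b :- a)) x a b) ,
    lt (+-nonneg-pos r (0<- h)) (solve 3 (λ x a b → b :- x := (a :- x) :+ (b :- a)) x a b)

module Series {c ℓ₁ ℓ₂ ℓ₃ : Level} (ℝ : RealField c ℓ₁ ℓ₂ ℓ₃) where
  open OrderedField ℝ public
  open MonoidSum +-monoid public using (sum; sum-syntax; sum⁺-syntax)

  partialSum : (ℕ → Carrier) → ℕ → Carrier
  partialSum a n = ∑[ i < n ] a (toℕ i)

  infix 4 _sumsTo_
  _sumsTo_ : (ℕ → Carrier) → Carrier → Set (c ⊔ ℓ₃)
  a sumsTo S = partialSum a ⟶ S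

  Summable : (ℕ → Carrier) → Set (c ⊔ ℓ₃)
  Summable a = ∃ λ S → a sumsTo S

  ∑∞ : ∀ a → Summable a → Carrier
  ∑∞ a = proj₁

  abstract
    ×1-nonneg : ∀ n → 0# ≤ n · 1#
    ×1-nonneg zero    = ≤-refl
    ×1-nonneg (suc n) = +-nonneg 0≤1 (×1-nonneg n)

    archimedean⁺ : ∀ x → ∃ λ k → 0# < k × x < k
    archimedean⁺ x with archimedean x
    ... | n , x<n = n · 1# + 1# , +-nonneg-pos (×1-nonneg n) 0<1 ,
      <-trans x<n (lt 0<1 (solve 2 (λ k o → k :+ o :- k := o) (n · 1#) 1#))

    scale : ∀ K ε → 0# < ε → ∃ λ δ → 0# < δ × K * δ < ε
    scale K ε 0<ε with archimedean⁺ K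
    ... | k , 0<k , K<k = ε ÷ k [ k#0 ] , 0<δ ,
      <-resp refl (trans (*-comm k _) (÷-* ε k k#0)) (*-monoʳ-< 0<δ K<k)
      where
      k#0 : k # 0#
      k#0 = 0<⇒#0 0<k
      0<δ : 0# < ε ÷ k [ k#0 ]
      0<δ = ÷-pos k#0 0<ε 0<k

    small : ∀ {x} K → (∀ ε → 0# < ε → x ≤ K * ε) → x ≤ 0#
    small {x} K h 0<x = let δ , 0<δ , Kδ<x = scale K x 0<x in h δ 0<δ Kδ<x

    lim-intro : ∀ {u L} K →
      (∀ ε → 0# < ε → ∃ λ N → ∀ n → N ℕ.≤ n → ∣ u n - L ∣≤ K * ε) → u ⟶ L
    lim-intro K h ε 0<ε =
      let δ , 0<δ , Kδ<ε = scale K ε 0<ε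
          N , f          = h δ 0<δ
      in N , λ n N≤n → ∣∣≤⇒< Kδ<ε (f n N≤n)

    cauchy-intro : ∀ {u} K →
      (∀ ε → 0# < ε → ∃ λ N → ∀ k → ∣ u (N ℕ.+ k) - u N ∣≤ K * ε) → Cauchy u
    cauchy-intro {u} K h ε 0<ε with scale (K + K) ε 0<ε
    ... | δ , 0<δ , Kδ<ε with h δ 0<δ
    ...   | N , f = N , λ m n N≤m N≤n → ∣∣≤⇒< Kδ<ε
      (∣∣-resp (solve 3 (λ x y z → (x :- z) :+ :- (y :- z) := x :- y) (u m) (u n) (u N))
               (sym (distribʳ δ K K))
               (∣∣-+ (g m N≤m) (∣∣-neg (g n N≤n))))
      where
      g : ∀ m → N ℕ.≤ m → ∣ u m - u N ∣≤ K * δ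
      g m N≤m with ℕₚ.m≤n⇒∃[o]m+o≡n N≤m
      ... | k , ≡.refl = f k

    lim-resp : ∀ {u v L M} → (∀ n → u n ≈ v n) → L ≈ M → u ⟶ L → v ⟶ M
    lim-resp e f h ε 0<ε with h ε 0<ε
    ... | N , g = N , λ n N≤n →
      <-resp refl (+-cong (e n) (-‿cong f)) (proj₁ (g n N≤n)) ,
      <-resp (+-cong (e n) (-‿cong f)) refl (proj₂ (g n N≤n))

    lim-unshift : ∀ {u L} N → (λ k → u (N ℕ.+ k)) ⟶ L → u ⟶ L
    lim-unshift {u} {L} N h ε 0<ε with h ε 0<ε
    ... | M , g = N ℕ.+ M , f
      where
      f : ∀ n → N ℕ.+ M ℕ.≤ n → ∣ u n - L ∣< ε
      f n p with ℕₚ.m≤n⇒∃[o]m+o≡n p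
      ... | k , ≡.refl rewrite ℕₚ.+-assoc N M k = g (M ℕ.+ k) (ℕₚ.m≤m+n M k)

    lim-shift : ∀ {u L} N → u ⟶ L → (λ k → u (N ℕ.+ k)) ⟶ L
    lim-shift N h ε 0<ε with h ε 0<ε
    ... | M , g = M , λ n p → g (N ℕ.+ n) (ℕₚ.≤-trans p (ℕₚ.m≤n+m n N))

    lim-+ : ∀ {u v L M} → u ⟶ L → v ⟶ M → (λ n → u n + v n) ⟶ L + M
    lim-+ {u} {v} {L} {M} h g = lim-intro (1# + 1#) λ ε 0<ε →
      let N₁ , f₁ = h ε 0<ε
          N₂ , f₂ = g ε 0<ε
      in N₁ ℕ.⊔ N₂ , λ n p →
        ∣∣-resp (solve 4 (λ x y L M → (x :- L) :+ (y :- M) := (x :+ y) :- (L :+ M)) (u n) (v n) L M)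
          (solve 2 (λ o ε → o :* ε :+ o :* ε := (o :+ o) :* ε) 1# ε)
          (∣∣-+ (∣∣-resp refl (sym (*-identityˡ ε)) (∣∣<⇒≤ (f₁ n (ℕₚ.m⊔n≤o⇒m≤o N₁ N₂ p))))
                (∣∣-resp refl (sym (*-identityˡ ε)) (∣∣<⇒≤ (f₂ n (ℕₚ.m⊔n≤o⇒n≤o N₁ N₂ p)))))

    archimedean-∣∣ : ∀ x → ∃ λ k → ∣ x ∣≤ k
    archimedean-∣∣ x with archimedean⁺ x | archimedean⁺ (- x)
    ... | k , 0<k , x<k | l , 0<l , -x<l = k + l ,
      ≤-resp refl (solve 3 (λ k l x → k :+ (l :- :- x) := (k :+ l) :+ x) k l x) (+-nonneg (<⇒≤ 0<k) (0≤- (<⇒≤ -x<l))) ,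
      ≤-resp refl (solve 3 (λ k l x → l :+ (k :- x) := (k :+ l) :- x) k l x) (+-nonneg (<⇒≤ 0<l) (0≤- (<⇒≤ x<k)))

    lim-* : ∀ {u L} x → u ⟶ L → (λ n → x * u n) ⟶ x * L
    lim-* {u} {L} x h with archimedean-∣∣ x
    ... | k , b = lim-intro k λ ε 0<ε →
      let N , f = h ε 0<ε
      in N , λ n p → ∣∣-resp (solve 3 (λ x u L → x :* (u :- L) := x :* u :- x :* L) x (u n) L) refl
                       (∣∣-* b (∣∣<⇒≤ (f n p)))

    lim-neg : ∀ {u L} → u ⟶ L → (λ n → - u n) ⟶ - L
    lim-neg {u} {L} h = lim-resp (λ n → minus (u n)) (minus L) (lim-* (- 1#) h)
      where
      minus : ∀ x → - 1# * x ≈ - x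
      minus = solve 1 (λ x → :- :1 :* x := :- x)

    lim-const : ∀ x → (λ _ → x) ⟶ x
    lim-const x = lim-intro 1# λ ε 0<ε → 0 , λ _ _ →
      ∣∣-resp (sym (-‿inverseʳ x)) (sym (*-identityˡ ε)) (∣∣-mono (<⇒≤ 0<ε) (∣∣-nonneg ≤-refl))

    lim-unique : ∀ {u L M} → u ⟶ L → u ⟶ M → L ≈ M
    lim-unique {u} {L} {M} h g = ≤-antisym (half h g) (half g h)
      where
      half : ∀ {L M} → u ⟶ L → u ⟶ M → L ≤ M
      half {L} {M} h g = le (0≤- {L - M} {0#} (small (1# + 1#) close)) (solve 2 (λ L M → M :- L := :0 :- (L :- M)) L M)
        where
        close : ∀ ε → 0# < ε → L - M ≤ (1# + 1#) * ε
        close ε 0<ε with h ε 0<ε | g ε 0<ε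
        ... | N₁ , f₁ | N₂ , f₂ =
          ∣∣-≤ (∣∣-resp (solve 3 (λ x L M → (x :- M) :+ :- (x :- L) := L :- M) (u n) L M)
            (solve 1 (λ ε → ε :+ ε := (:1 :+ :1) :* ε) ε)
            (∣∣-+ (∣∣<⇒≤ (f₂ n (ℕₚ.m≤n⊔m N₁ N₂))) (∣∣-neg (∣∣<⇒≤ (f₁ n (ℕₚ.m≤m⊔n N₁ N₂))))))
          where
          n : ℕ
          n = N₁ ℕ.⊔ N₂

    lim-nonneg : ∀ {u L} → (∀ n → 0# ≤ u n) → u ⟶ L → 0# ≤ L
    lim-nonneg {u} {L} p h = le (0≤- {0# - L} {0#} (small 1# close)) (solve 1 (λ L → L :- :0 := :0 :- (:0 :- L)) L)
      where
      close : ∀ ε → 0# < ε → 0# - L ≤ 1# * ε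
      close ε 0<ε with h ε 0<ε
      ... | N , f = le (+-nonneg (p N) (proj₂ (∣∣<⇒≤ (f N ℕₚ.≤-refl))))
        (solve 3 (λ u L ε → :1 :* ε :- (:0 :- L) := u :+ (ε :- (u :- L))) (u N) L ε)

    partialSum-cong : ∀ {a b} → (∀ i → a i ≈ b i) → ∀ n → partialSum a n ≈ partialSum b n
    partialSum-cong e zero    = refl
    partialSum-cong e (suc n) = +-cong (e 0) (partialSum-cong (λ i → e (suc i)) n)

    partialSum-+ : ∀ a b n → partialSum (λ i → a i + b i) n ≈ partialSum a n + partialSum b n
    partialSum-+ a b zero    = sym (+-identityˡ 0#)
    partialSum-+ a b (suc n) = trans (+-congˡ (partialSum-+ (λ i → a (suc i)) (λ i → b (suc i)) n))
      (solve 4 (λ x y s t → (x :+ y) :+ (s :+ t) := (x :+ s) :+ (y :+ t)) _ _ _ _)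

    partialSum-* : ∀ x a n → partialSum (λ i → x * a i) n ≈ x * partialSum a n
    partialSum-* x a zero    = sym (zeroʳ x)
    partialSum-* x a (suc n) = trans (+-congˡ (partialSum-* x (λ i → a (suc i)) n)) (sym (distribˡ x _ _))

    partialSum-split : ∀ a N k → partialSum a (N ℕ.+ k) ≈ partialSum a N + partialSum (λ i → a (N ℕ.+ i)) k
    partialSum-split a zero    k = sym (+-identityˡ _)
    partialSum-split a (suc N) k = trans (+-congˡ (partialSum-split (λ i → a (suc i)) N k)) (sym (+-assoc _ _ _))

    partialSum-∣∣ : ∀ {a b} → (∀ i → ∣ a i ∣≤ b i) → ∀ n → ∣ partialSum a n ∣≤ partialSum b n
    partialSum-∣∣ h zero    = ∣∣-nonneg ≤-refl
    partialSum-∣∣ h (suc n) = ∣∣-+ (h 0) (partialSum-∣∣ (λ i → h (suc i)) n)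

    partialSum-nonneg : ∀ {a} → (∀ i → 0# ≤ a i) → ∀ n → 0# ≤ partialSum a n
    partialSum-nonneg h zero    = ≤-refl
    partialSum-nonneg h (suc n) = +-nonneg (h 0) (partialSum-nonneg (λ i → h (suc i)) n)

    sumsTo-unique : ∀ {a S T} → a sumsTo S → a sumsTo T → S ≈ T
    sumsTo-unique = lim-unique

    sumsTo-resp : ∀ {a b S T} → (∀ i → a i ≈ b i) → S ≈ T → a sumsTo S → b sumsTo T
    sumsTo-resp e = lim-resp (partialSum-cong e)

    sumsTo-+ : ∀ {a b S T} → a sumsTo S → b sumsTo T → (λ i → a i + b i) sumsTo (S + T)
    sumsTo-+ {a} {b} h g = lim-resp (λ n → sym (partialSum-+ a b n)) refl (lim-+ h g)

    sumsTo-* : ∀ {a S} x → a sumsTo S → (λ i → x * a i) sumsTo (x * S)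
    sumsTo-* {a} x h = lim-resp (λ n → sym (partialSum-* x a n)) refl (lim-* x h)

    sumsTo-drop : ∀ {a S} N → a sumsTo S → (λ i → a (N ℕ.+ i)) sumsTo (S - partialSum a N)
    sumsTo-drop {a} {S} N h = lim-resp
      (λ n → trans (+-congʳ (partialSum-split a N n)) (solve 2 (λ x y → (x :+ y) :- x := y) (partialSum a N) _))
      refl (lim-+ (lim-shift N h) (lim-const (- partialSum a N)))

    sumsTo-undrop : ∀ {a S} N → (λ i → a (N ℕ.+ i)) sumsTo S → a sumsTo (partialSum a N + S)
    sumsTo-undrop {a} N h = lim-unshift N (lim-resp (λ n → sym (partialSum-split a N n)) refl (lim-+ (lim-const _) h))

    sumsTo-nonneg : ∀ {a S} → (∀ i → 0# ≤ a i) → a sumsTo S → 0# ≤ S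
    sumsTo-nonneg h = lim-nonneg (partialSum-nonneg h)

    sumsTo-pos : ∀ {a S} → (∀ i → 0# < a i) → a sumsTo S → 0# < S
    sumsTo-pos {a} {S} h g = <-resp refl (solve 2 (λ x S → (S :- (x :+ :0)) :+ x := S) (a 0) S)
      (+-nonneg-pos (sumsTo-nonneg (λ i → <⇒≤ (h (suc i))) (sumsTo-drop {a} 1 g)) (h 0))

    sumsTo-∣∣ : ∀ {a b S T} → (∀ i → ∣ a i ∣≤ b i) → a sumsTo S → b sumsTo T → ∣ S ∣≤ T
    sumsTo-∣∣ {a} {b} h f g =
      sumsTo-nonneg (λ i → proj₁ (h i)) (sumsTo-+ {b} {a} g f) ,
      lim-nonneg (λ n → proj₂ (partialSum-∣∣ h n)) (lim-+ g (lim-neg f))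

    compare : ∀ {a b} → (∀ i → ∣ a i ∣≤ b i) → Summable b → Summable a
    compare {a} {b} h (S , g) = complete (partialSum a) (cauchy-intro (1# + 1#) close)
      where
      close : ∀ ε → 0# < ε → ∃ λ N → ∀ k → ∣ partialSum a (N ℕ.+ k) - partialSum a N ∣≤ (1# + 1#) * ε
      close ε 0<ε with g ε 0<ε
      ... | N , f = N , λ k → ∣∣-resp
        (trans (solve 2 (λ x y → y := (x :+ y) :- x) (partialSum a N) _) (+-congʳ (sym (partialSum-split a N k)))) refl
        (∣∣-mono (tail k) (partialSum-∣∣ (λ i → h (N ℕ.+ i)) k))
        where
        tail : ∀ k → partialSum (λ i → b (N ℕ.+ i)) k ≤ (1# + 1#) * ε
        tail k = ∣∣-≤ (∣∣-resp
          (trans (+-congʳ (+-congʳ (partialSum-split b N k))) (solve 3 (λ x y S → (x :+ y :- S) :+ :- (x :- S) := y) (partialSum b N) _ S))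
          (solve 1 (λ ε → ε :+ ε := (:1 :+ :1) :* ε) ε)
          (∣∣-+ (∣∣<⇒≤ (f (N ℕ.+ k) (ℕₚ.m≤m+n N k))) (∣∣-neg (∣∣<⇒≤ (f N ℕₚ.≤-refl)))))

    summable-* : ∀ {a} x → Summable a → Summable (λ i → x * a i)
    summable-* {a} x (S , h) = x * S , sumsTo-* {a} x h

    summable-undrop : ∀ {a} N → Summable (λ i → a (N ℕ.+ i)) → Summable a
    summable-undrop {a} N (S , h) = _ , sumsTo-undrop {a} N h

    bernoulli : ∀ {ρ} → 0# < ρ → ρ < 1# → ∀ n → ρ ^ n * (1# + n · 1# * (1# - ρ)) ≤ 1#
    bernoulli {ρ} p h zero = ≤-reflexive (solve 1 (λ d → :1 :* (:1 :+ :0 :* d) := :1) (1# - ρ))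
    bernoulli {ρ} p h (suc n) = ≤-trans
      (le (*-nonneg (*-nonneg (<⇒≤ (^-pos p n)) (+-nonneg 0≤1 (×1-nonneg n))) (*-nonneg 0≤d 0≤d))
        (solve 3 (λ r z n → z :* (:1 :+ n :* (:1 :- r)) :- r :* z :* (:1 :+ (:1 :+ n) :* (:1 :- r))
                     := z :* (:1 :+ n) :* ((:1 :- r) :* (:1 :- r))) ρ (ρ ^ n) (n · 1#)))
      (bernoulli p h n)
      where
      0≤d : 0# ≤ 1# - ρ
      0≤d = 0≤- (<⇒≤ h)

    ^-small : ∀ {ρ} → 0# < ρ → ρ < 1# → ∀ ε → 0# < ε → ∃ λ N → ∀ n → N ℕ.≤ n → ρ ^ n ≤ ε
    ^-small {ρ} p h ε 0<ε with archimedean (1# ÷ ((1# - ρ) * ε) [ 0<⇒#0 (*-pos (0<- h) 0<ε) ])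
    ... | N , K<N = N , g
      where
      d : Carrier
      d = 1# - ρ
      dε>0 : 0# < d * ε
      dε>0 = *-pos (0<- h) 0<ε
      1<Ndε : 1# < N · 1# * (d * ε)
      1<Ndε = <-resp (÷-* 1# (d * ε) (0<⇒#0 dε>0)) refl (*-monoʳ-< dε>0 K<N)
      atN : ρ ^ N ≤ ε
      atN ε<ρN = bernoulli p h N (<-≤-trans 1<Ndε (≤-trans
        (≤-resp refl (solve 3 (λ n d z → n :* d :* z := z :* (n :* d)) (N · 1#) d (ρ ^ N))
          (≤-resp (*-assoc _ d ε) refl (*-monoˡ-≤ (*-nonneg (×1-nonneg N) (<⇒≤ (0<- h))) (<⇒≤ ε<ρN))))
        (*-monoˡ-≤ (<⇒≤ (^-pos p N)) (le 0≤1 (solve 1 (λ x → :1 :+ x :- x := :1) (N · 1# * d))))))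
      g : ∀ n → N ℕ.≤ n → ρ ^ n ≤ ε
      g n N≤n with ℕₚ.m≤n⇒∃[o]m+o≡n N≤n
      ... | k , ≡.refl = ≤-trans (^-anti p (<⇒≤ h) N k) atN

    geometric-partial : ∀ ρ n → partialSum (ρ ^_) n * (1# - ρ) ≈ 1# - ρ ^ n
    geometric-partial ρ zero    = solve 1 (λ r → :0 :* (:1 :- r) := :1 :- :1) ρ
    geometric-partial ρ (suc n) = begin
      (1# + partialSum (λ i → ρ * ρ ^ i) n) * (1# - ρ)       ≈⟨ *-congʳ (+-congˡ (partialSum-* ρ (ρ ^_) n)) ⟩
      (1# + ρ * partialSum (ρ ^_) n) * (1# - ρ)              ≈⟨ solve 2 (λ r s → (:1 :+ r :* s) :* (:1 :- r) := :1 :- r :+ r :* (s :* (:1 :- r))) ρ _ ⟩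
      1# - ρ + ρ * (partialSum (ρ ^_) n * (1# - ρ))          ≈⟨ +-congˡ (*-congˡ (geometric-partial ρ n)) ⟩
      1# - ρ + ρ * (1# - ρ ^ n)                              ≈⟨ solve 2 (λ r z → :1 :- r :+ r :* (:1 :- z) := :1 :- r :* z) ρ (ρ ^ n) ⟩
      1# - ρ * ρ ^ n                                         ∎

    geometric : ∀ {ρ} → 0# < ρ → ρ < 1# → Summable (ρ ^_)
    geometric {ρ} p h = S , lim-intro S close
      where
      d#0 : (1# - ρ) # 0#
      d#0 = 0<⇒#0 (0<- h)
      S : Carrier
      S = 1# ÷ (1# - ρ) [ d#0 ]
      0<S : 0# < S
      0<S = ÷-pos d#0 0<1 (0<- h)
      diff : ∀ n → S * - ρ ^ n ≈ partialSum (ρ ^_) n - S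
      diff n = *-cancelʳ (1# - ρ) d#0 (begin
        S * - ρ ^ n * (1# - ρ)                         ≈⟨ solve 3 (λ S z d → S :* :- z :* d := :- z :* (S :* d)) S (ρ ^ n) (1# - ρ) ⟩
        - ρ ^ n * (S * (1# - ρ))                       ≈⟨ *-congˡ (÷-* 1# (1# - ρ) d#0) ⟩
        - ρ ^ n * 1#                                   ≈⟨ solve 1 (λ z → :- z :* :1 := (:1 :- z) :- :1) (ρ ^ n) ⟩
        (1# - ρ ^ n) - 1#                              ≈⟨ +-cong (geometric-partial ρ n) (-‿cong (÷-* 1# (1# - ρ) d#0)) ⟨
        partialSum (ρ ^_) n * (1# - ρ) - S * (1# - ρ)  ≈⟨ solve 3 (λ P S d → P :* d :- S :* d := (P :- S) :* d) _ S (1# - ρ) ⟩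
        (partialSum (ρ ^_) n - S) * (1# - ρ)           ∎)
      close : ∀ ε → 0# < ε → ∃ λ N → ∀ n → N ℕ.≤ n → ∣ partialSum (ρ ^_) n - S ∣≤ S * ε
      close ε 0<ε with ^-small p h ε 0<ε
      ... | N , f = N , λ n N≤n → ∣∣-resp (diff n) refl
        (∣∣-* (∣∣-nonneg (<⇒≤ 0<S)) (∣∣-neg (∣∣-mono (f n N≤n) (∣∣-nonneg (<⇒≤ (^-pos p n))))))

module QCalculus {c ℓ₁ ℓ₂ ℓ₃ : Level} (ℝ : RealField c ℓ₁ ℓ₂ ℓ₃) where
  open Series ℝ public

  module Base (q : Carrier) (0<q : 0# < q) (q<1 : q < 1#) where
    abstract
      0<1-q : 0# < 1# - q
      0<1-q = 0<- q<1

      1-q#0 : (1# - q) # 0#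
      1-q#0 = 0<⇒#0 0<1-q

    qint : ℕ → Carrier
    qint m = (1# - q ^ m) ÷ (1# - q) [ 1-q#0 ]

    qfact : ℕ → Carrier
    qfact zero    = 1#
    qfact (suc m) = qfact m * qint (suc m)

    -- oddfact m is [2m-1]!!
    oddfact : ℕ → Carrier
    oddfact zero    = 1#
    oddfact (suc m) = qint (2 ℕ.* m ℕ.+ 1) * oddfact m

    abstract
      1≤qint : ∀ m → 1# ≤ qint (suc m)
      1≤qint m h = le (0≤- (^-anti 0<q (<⇒≤ q<1) 1 m))
        (solve 2 (λ y z → (:1 :- z) :- (:1 :- y :* :1) := y :* :1 :- z) q (q ^ suc m))
        (<-resp (÷-* (1# - q ^ suc m) (1# - q) 1-q#0) (solve 1 (λ y → :1 :* (:1 :- y) := :1 :- y :* :1) q) (*-monoʳ-< 0<1-q h))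

      1≤qfact : ∀ m → 1# ≤ qfact m
      1≤qfact zero    = ≤-refl
      1≤qfact (suc m) = ≤-resp (*-identityˡ 1#) refl
        (*-mono-≤ 0≤1 (≤-trans 0≤1 (1≤qint m)) (1≤qfact m) (1≤qint m))

      0<qfact : ∀ m → 0# < qfact m
      0<qfact m = <-≤-trans 0<1 (1≤qfact m)

      qfact#0 : ∀ m → qfact m # 0#
      qfact#0 m = 0<⇒#0 (0<qfact m)

      qint#0 : ∀ m → qint (suc m) # 0#
      qint#0 m = 0<⇒#0 (<-≤-trans 0<1 (1≤qint m))

      ^*qfact#0 : ∀ k m → (q ^ k * qfact m) # 0#
      ^*qfact#0 k m = 0<⇒#0 (*-pos (^-pos 0<q k) (0<qfact m))

    -- E x is the q-exponential written E_q^x.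
    Eterm : Carrier → ℕ → Carrier
    Eterm x m = (q ^ (m C 2) * x ^ m) ÷ qfact m [ qfact#0 m ]

    abstract
      Eterm-zero : ∀ x → Eterm x 0 ≈ 1#
      Eterm-zero x = trans (sym (*-identityʳ _)) (trans (÷-* (1# * 1#) 1# (qfact#0 0)) (*-identityʳ 1#))

      ^-C-suc : ∀ m → q ^ (suc m C 2) ≈ q ^ m * q ^ (m C 2)
      ^-C-suc m = trans (reflexive (≡.cong (q ^_) (≡.sym (≡.trans (≡.cong (ℕ._+ m C 2) (≡.sym (nC1≡n m))) (nCk+nC[k+1]≡[n+1]C[k+1] m 1)))))
        (^-homo-* q m (m C 2))

      Eterm-suc : ∀ x m → Eterm x (suc m) * qint (suc m) ≈ q ^ m * x * Eterm x m
      Eterm-suc x m = *-cancelʳ (qfact m) (qfact#0 m) (begin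
        Eterm x (suc m) * qint (suc m) * qfact m     ≈⟨ solve 3 (λ e i k → e :* i :* k := e :* (k :* i)) _ _ _ ⟩
        Eterm x (suc m) * qfact (suc m)              ≈⟨ ÷-* _ (qfact (suc m)) (qfact#0 (suc m)) ⟩
        q ^ (suc m C 2) * (x * x ^ m)                ≈⟨ *-congʳ (^-C-suc m) ⟩
        q ^ m * q ^ (m C 2) * (x * x ^ m)            ≈⟨ solve 4 (λ a b x y → a :* b :* (x :* y) := a :* x :* (b :* y)) (q ^ m) (q ^ (m C 2)) x (x ^ m) ⟩
        q ^ m * x * (q ^ (m C 2) * x ^ m)            ≈⟨ *-congˡ (÷-* _ (qfact m) (qfact#0 m)) ⟨
        q ^ m * x * (Eterm x m * qfact m)            ≈⟨ *-assoc _ _ _ ⟨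
        q ^ m * x * Eterm x m * qfact m              ∎)

      ∣∣-cancel : ∀ {z k B} → 1# ≤ k → ∣ z * k ∣≤ B → ∣ z ∣≤ B
      ∣∣-cancel {z} {k} {B} 1≤k h = ∣∣-resp eq (*-identityʳ B) (∣∣-* h (∣∣-mono j≤1 (∣∣-nonneg (<⇒≤ 0<j))))
        where
        0<k : 0# < k
        0<k = <-≤-trans 0<1 1≤k
        k#0 : k # 0#
        k#0 = 0<⇒#0 0<k
        j : Carrier
        j = 1# ÷ k [ k#0 ]
        0<j : 0# < j
        0<j = ÷-pos k#0 0<1 0<k
        j≤1 : j ≤ 1#
        j≤1 g = 1≤k (<-resp (*-identityˡ k) (÷-* 1# k k#0) (*-monoʳ-< 0<k g))
        eq : z * k * j ≈ z
        eq = trans (solve 3 (λ z k j → z :* k :* j := z :* (j :* k)) z k j) (trans (*-congˡ (÷-* 1# k k#0)) (*-identityʳ z))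

      ∣q^∣ : ∀ m → ∣ q ^ m ∣≤ q ^ m
      ∣q^∣ m = ∣∣-nonneg (<⇒≤ (^-pos 0<q m))

    majorant : Carrier → ℕ → Carrier
    majorant X zero    = 1#
    majorant X (suc m) = q ^ m * X * majorant X m

    abstract
      ∣Eterm∣ : ∀ {x X} → ∣ x ∣≤ X → ∀ m → ∣ Eterm x m ∣≤ majorant X m
      ∣Eterm∣ {x} h zero    = ∣∣-resp (sym (Eterm-zero x)) refl (∣∣-nonneg 0≤1)
      ∣Eterm∣ {x} h (suc m) = ∣∣-cancel (1≤qint m) (∣∣-resp (sym (Eterm-suc x m)) refl
        (∣∣-* (∣∣-* (∣q^∣ m) h) (∣Eterm∣ h m)))

      majorant-nonneg : ∀ {X} → 0# ≤ X → ∀ m → 0# ≤ majorant X m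
      majorant-nonneg h zero    = 0≤1
      majorant-nonneg h (suc m) = *-nonneg (*-nonneg (<⇒≤ (^-pos 0<q m)) h) (majorant-nonneg h m)

      majorant-summable : ∀ {X} → 0# ≤ X → Summable (majorant X)
      majorant-summable {X} 0≤X with scale X q 0<q
      ... | δ , 0<δ , Xδ<q with ^-small 0<q q<1 δ 0<δ
      ...   | N , q^≤δ = summable-undrop {majorant X} N
        (compare {b = λ k → majorant X N * q ^ k} (λ k → ∣∣-mono (bound k) (∣∣-nonneg (majorant-nonneg 0≤X (N ℕ.+ k))))
          (summable-* {q ^_} (majorant X N) (geometric 0<q q<1)))
        where
        ratio : ∀ k → q ^ (N ℕ.+ k) * X ≤ q
        ratio k = ≤-trans (*-monoʳ-≤ 0≤X (q^≤δ (N ℕ.+ k) (ℕₚ.m≤m+n N k))) (≤-resp (*-comm X δ) refl (<⇒≤ Xδ<q))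
        bound : ∀ k → majorant X (N ℕ.+ k) ≤ majorant X N * q ^ k
        bound zero    rewrite ℕₚ.+-identityʳ N = ≤-reflexive (sym (*-identityʳ _))
        bound (suc k) rewrite ℕₚ.+-suc N k = ≤-resp refl
          (solve 3 (λ y b z → y :* (b :* z) := b :* (y :* z)) q (majorant X N) (q ^ k))
          (*-mono-≤ (*-nonneg (<⇒≤ (^-pos 0<q (N ℕ.+ k))) 0≤X)
            (*-nonneg (majorant-nonneg 0≤X N) (<⇒≤ (^-pos 0<q k))) (ratio k) (bound k))

      E-summable : ∀ x → Summable (Eterm x)
      E-summable x = let X , h = archimedean-∣∣ x in compare {b = majorant X} (∣Eterm∣ h) (majorant-summable (∣∣-bound h))

    E : Carrier → Carrier
    E x = ∑∞ (Eterm x) (E-summable x)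

    abstract
      E-sums : ∀ x → Eterm x sumsTo E x
      E-sums x = proj₂ (E-summable x)

      Eterm-cong : ∀ {x y} → x ≈ y → ∀ m → Eterm x m ≈ Eterm y m
      Eterm-cong e m = *-congʳ (*-congˡ (^-congˡ m e))

      E-cong : ∀ {x y} → x ≈ y → E x ≈ E y
      E-cong {x} {y} e = sumsTo-unique {Eterm y} (sumsTo-resp {Eterm x} (Eterm-cong e) refl (E-sums x)) (E-sums y)

      E-bound : ∀ {X} → 0# ≤ X → ∃ λ B → ∀ x → ∣ x ∣≤ X → ∣ E x ∣≤ B
      E-bound {X} 0≤X = let B , h = majorant-summable 0≤X in B , λ x b → sumsTo-∣∣ {Eterm x} {majorant X} (∣Eterm∣ b) (E-sums x) h

      Eterm-scale : ∀ x m → Eterm (q * x) m ≈ q ^ m * Eterm x m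
      Eterm-scale x m = trans (*-congʳ (*-congˡ (^-distrib-* q x m)))
        (solve 4 (λ a y z i → a :* (y :* z) :* i := y :* (a :* z :* i)) (q ^ (m C 2)) (q ^ m) (x ^ m) _)

      E-functional : ∀ x → E x ≈ (1# + (1# - q) * x) * E (q * x)
      E-functional x = begin
        E x                                                ≈⟨ solve 2 (λ a b → a := (a :+ :- :1 :* b) :+ b) (E x) (E (q * x)) ⟩
        (E x + - 1# * E (q * x)) + E (q * x)               ≈⟨ +-congʳ (trans (solve 1 (λ a → a := (a :- (:0 :+ :0)) :+ :0) _)
                                                                (+-congʳ (+-congˡ (-‿cong (+-congʳ (sym d-zero)))))) ⟩
        (E x + - 1# * E (q * x) - partialSum d 1) + 0# + E (q * x)
                                                           ≈⟨ +-congʳ (+-congʳ (sumsTo-unique {λ m → k * Eterm (q * x) m}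
                                                                (sumsTo-resp {λ i → d (1 ℕ.+ i)} d-suc refl (sumsTo-drop {d} 1 d-sums))
                                                                (sumsTo-* {Eterm (q * x)} k (E-sums (q * x))))) ⟩
        k * E (q * x) + 0# + E (q * x)                     ≈⟨ solve 2 (λ k e → k :* e :+ :0 :+ e := (:1 :+ k) :* e) k (E (q * x)) ⟩
        (1# + k) * E (q * x)                               ∎
        where
        k : Carrier
        k = (1# - q) * x
        d : ℕ → Carrier
        d m = Eterm x m + - 1# * Eterm (q * x) m
        d-sums : d sumsTo (E x + - 1# * E (q * x))
        d-sums = sumsTo-+ {Eterm x} {λ m → - 1# * Eterm (q * x) m} (E-sums x) (sumsTo-* {Eterm (q * x)} (- 1#) (E-sums (q * x)))
        d-zero : d 0 ≈ 0#
        d-zero = trans (+-cong (Eterm-zero x) (*-congˡ (Eterm-zero (q * x)))) (solve 0 (:1 :+ :- :1 :* :1 := :0))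
        d-suc : ∀ m → d (suc m) ≈ k * Eterm (q * x) m
        d-suc m = begin
          Eterm x (suc m) + - 1# * Eterm (q * x) (suc m)           ≈⟨ +-congˡ (*-congˡ (Eterm-scale x (suc m))) ⟩
          Eterm x (suc m) + - 1# * (q ^ suc m * Eterm x (suc m))   ≈⟨ solve 2 (λ e y → e :+ :- :1 :* (y :* e) := e :* (:1 :- y)) (Eterm x (suc m)) (q ^ suc m) ⟩
          Eterm x (suc m) * (1# - q ^ suc m)                       ≈⟨ *-congˡ (÷-* (1# - q ^ suc m) (1# - q) 1-q#0) ⟨
          Eterm x (suc m) * (qint (suc m) * (1# - q))              ≈⟨ *-assoc _ _ _ ⟨
          Eterm x (suc m) * qint (suc m) * (1# - q)                ≈⟨ *-congʳ (Eterm-suc x m) ⟩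
          q ^ m * x * Eterm x m * (1# - q)                         ≈⟨ solve 4 (λ a x e y → a :* x :* e :* y := y :* x :* (a :* e)) (q ^ m) x (Eterm x m) (1# - q) ⟩
          k * (q ^ m * Eterm x m)                                  ≈⟨ *-congˡ (Eterm-scale x m) ⟨
          k * Eterm (q * x) m                                      ∎

      E-near-0 : ∀ {X} → 0# ≤ X → ∃ λ B → (0# ≤ B) × (∀ x δ → 0# ≤ δ → δ ≤ 1# → ∣ x ∣≤ δ * X → ∣ E x - 1# ∣≤ δ * (X * B))
      E-near-0 {X} 0≤X = near (majorant-summable 0≤X)
        where
        near : Summable (majorant X) → ∃ λ B → (0# ≤ B) × (∀ x δ → 0# ≤ δ → δ ≤ 1# → ∣ x ∣≤ δ * X → ∣ E x - 1# ∣≤ δ * (X * B))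
        near (B , h) = B , sumsTo-nonneg {majorant X} (majorant-nonneg 0≤X) h , λ x δ 0≤δ δ≤1 b →
          ∣∣-resp (+-congˡ (-‿cong (trans (+-identityʳ _) (Eterm-zero x)))) (*-assoc δ X B)
            (sumsTo-∣∣ {λ i → Eterm x (1 ℕ.+ i)} {λ i → δ * X * majorant X i}
              (λ m → ∣∣-cancel (1≤qint m) (∣∣-resp (sym (Eterm-suc x m)) refl
                (∣∣-* (∣∣-resp refl (*-identityˡ (δ * X)) (∣∣-* (∣∣-mono (^≤1 (<⇒≤ 0<q) (<⇒≤ q<1) m) (∣q^∣ m)) b))
                      (∣Eterm∣ (∣∣-mono (≤-resp refl (*-identityˡ X) (*-monoʳ-≤ 0≤X δ≤1)) b) m))))
              (sumsTo-drop {Eterm x} 1 (E-sums x))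
              (sumsTo-* {majorant X} (δ * X) h))

      E-pos-near-0 : ∀ x → ∃ λ N → 0# < E (q ^ N * x)
      E-pos-near-0 x = near (E-near-0 0≤X)
        where
        X : Carrier
        X = proj₁ (archimedean-∣∣ x)
        h : ∣ x ∣≤ X
        h = proj₂ (archimedean-∣∣ x)
        0≤X : 0# ≤ X
        0≤X = ∣∣-bound h
        near : (∃ λ B → (0# ≤ B) × (∀ x δ → 0# ≤ δ → δ ≤ 1# → ∣ x ∣≤ δ * X → ∣ E x - 1# ∣≤ δ * (X * B))) →
               ∃ λ N → 0# < E (q ^ N * x)
        near (B , 0≤B , f) =
          let δ , 0<δ , XBδ<1 = scale (X * B) 1# 0<1
              N , q^≤δ        = ^-small 0<q q<1 δ 0<δ
          in N , <-resp refl (solve 2 (λ e k → (k :+ (e :- :1)) :+ (:1 :- k) := e) (E (q ^ N * x)) (q ^ N * (X * B)))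
          (+-nonneg-pos (proj₁ (f (q ^ N * x) (q ^ N) (<⇒≤ (^-pos 0<q N)) (^≤1 (<⇒≤ 0<q) (<⇒≤ q<1) N) (∣∣-* (∣q^∣ N) h)))
            (0<- (≤-<-trans (*-monoʳ-≤ (*-nonneg 0≤X 0≤B) (q^≤δ N ℕₚ.≤-refl)) (<-respˡ (*-comm (X * B) δ) XBδ<1))))

      E-pos : ∀ x → x ≤ 0# → 0# < 1# + (1# - q) * x → 0# < E x
      E-pos x x≤0 h = let N , p = E-pos-near-0 x in descend N x x≤0 h p
        where
        descend : ∀ N x → x ≤ 0# → 0# < 1# + (1# - q) * x → 0# < E (q ^ N * x) → 0# < E x
        descend zero    x x≤0 h p = <-respʳ (E-cong (*-identityˡ x)) p
        descend (suc N) x x≤0 h p = <-respʳ (sym (E-functional x)) (*-pos h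
          (descend N (q * x)
            (le (*-nonneg (<⇒≤ 0<q) (0≤- x≤0)) (solve 2 (λ y x → :0 :- y :* x := y :* (:0 :- x)) q x))
            (<-respʳ (solve 2 (λ y x → (:1 :- y) :* ((:1 :- y) :* (:0 :- x)) :+ (:1 :+ (:1 :- y) :* x) := :1 :+ (:1 :- y) :* (y :* x)) q x)
              (+-nonneg-pos (*-nonneg (<⇒≤ 0<1-q) (*-nonneg (<⇒≤ 0<1-q) (0≤- x≤0))) h))
            (<-respʳ (E-cong (solve 3 (λ y z x → y :* z :* x := z :* (y :* x)) q (q ^ N) x)) p)))

module QHermite {c ℓ₁ ℓ₂ ℓ₃ : Level} (ℝ : RealField c ℓ₁ ℓ₂ ℓ₃) where
  open QCalculus ℝ public

  module Gaussian (q : Carrier) (0<q : 0# < q) (q<1 : q < 1#) where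
    open Base q 0<q q<1 public

    H : ℕ → Carrier → Carrier
    H zero          x = 1#
    H (suc zero)    x = x
    H (suc (suc n)) x = x * H (suc n) x - q ^ n * qint (suc n) * H n x

    abstract
      0<q² : 0# < q ^ 2
      0<q² = ^-pos 0<q 2

      q²<1 : q ^ 2 < 1#
      q²<1 = ^<1 0<q q<1 1

    module Base² = Base (q ^ 2) 0<q² q²<1

    wG : Carrier → Carrier
    wG x = Base².E (- (q ^ 2 * x ^ 2) ÷ qint 2 [ qint#0 1 ])

    abstract
      -- 1 - √(1-q) is the limit of the iteration y ↦ (q + y²)/2 from 0.
      √[1-q]-exists : ∃ λ r → (0# < r) × (r * r ≈ 1# - q)
      √[1-q]-exists = 1# - S , 0<r , r²
        where
        2# : Carrier
        2# = 1# + 1#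
        2#0 : 2# # 0#
        2#0 = 0<⇒#0 (+-pos 0<1 0<1)
        y : ℕ → Carrier
        y zero    = 0#
        y (suc n) = (q + y n * y n) ÷ 2# [ 2#0 ]
        2y : ∀ n → y (suc n) + y (suc n) ≈ q + y n * y n
        2y n = trans (solve 1 (λ y → y :+ y := y :* (:1 :+ :1)) (y (suc n))) (÷-* (q + y n * y n) 2# 2#0)
        ∣∣-half : ∀ {z b} → ∣ z + z ∣≤ b + b → ∣ z ∣≤ b
        ∣∣-half {z} {b} (p , r) =
          0≤-half (≤-resp refl (solve 2 (λ z b → (b :+ b) :+ (z :+ z) := (b :+ z) :+ (b :+ z)) z b) p) ,
          0≤-half (≤-resp refl (solve 2 (λ z b → (b :+ b) :- (z :+ z) := (b :- z) :+ (b :- z)) z b) r)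
        0≤q : 0# ≤ q
        0≤q = <⇒≤ 0<q
        qq≤q : q * q ≤ q
        qq≤q = ≤-resp refl (*-identityʳ q) (*-monoˡ-≤ 0≤q (<⇒≤ q<1))
        ∣y∣ : ∀ n → ∣ y n ∣≤ q
        ∣y∣ zero    = ∣∣-mono 0≤q (∣∣-nonneg ≤-refl)
        ∣y∣ (suc n) = ∣∣-half (∣∣-resp (sym (2y n)) refl
          (∣∣-+ (∣∣-nonneg 0≤q) (∣∣-mono qq≤q (∣∣-* (∣y∣ n) (∣y∣ n)))))
        d : ℕ → Carrier
        d n = y (suc n) - y n
        ∣d∣ : ∀ n → ∣ d n ∣≤ q * q ^ n
        ∣d∣ zero    = ∣∣-half (∣∣-resp (trans (trans (solve 1 (λ q → q := q :+ :0 :* :0) q) (sym (2y 0))) (solve 1 (λ y → y :+ y := (y :- :0) :+ (y :- :0)) (y 1))) refl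
          (∣∣-mono (le 0≤q (solve 1 (λ q → (q :* :1 :+ q :* :1) :- q := q) q)) (∣∣-nonneg 0≤q)))
        ∣d∣ (suc n) = ∣∣-half (∣∣-resp
          (trans (solve 3 (λ q a b → (a :- b) :* (a :+ b) := (q :+ a :* a) :- (q :+ b :* b)) q (y (suc n)) (y n))
            (trans (+-cong (sym (2y (suc n))) (-‿cong (sym (2y n)))) (solve 2 (λ a b → (a :+ a) :- (b :+ b) := (a :- b) :+ (a :- b)) (y (suc (suc n))) (y (suc n)))))
          (solve 2 (λ q z → q :* z :* (q :+ q) := q :* (q :* z) :+ q :* (q :* z)) q (q ^ n))
          (∣∣-* (∣d∣ n) (∣∣-+ (∣y∣ (suc n)) (∣y∣ n))))
        d-summable : Summable d
        d-summable = compare {b = λ n → q * q ^ n} ∣d∣ (summable-* {q ^_} q (geometric 0<q q<1))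
        S : Carrier
        S = proj₁ d-summable
        telescope : ∀ (u : ℕ → Carrier) n → partialSum (λ i → u (suc i) - u i) n ≈ u n - u 0
        telescope u zero    = sym (-‿inverseʳ (u 0))
        telescope u (suc n) = trans (+-congˡ (telescope (λ i → u (suc i)) n))
          (solve 3 (λ a b c → (b :- a) :+ (c :- b) := c :- a) (u 0) (u 1) (u (suc n)))
        y-lim : y ⟶ S
        y-lim = lim-resp (λ n → trans (telescope y n) (solve 1 (λ y → y :- :0 := y) (y n))) refl (proj₂ d-summable)
        ∣S∣ : ∣ S ∣≤ q
        ∣S∣ = lim-nonneg (λ n → proj₁ (∣y∣ n)) (lim-+ (lim-const q) y-lim) ,
              lim-nonneg (λ n → proj₂ (∣y∣ n)) (lim-+ (lim-const q) (lim-neg y-lim))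
        y²-lim : (λ n → y n * y n) ⟶ S * S
        y²-lim = lim-intro (q + q) λ ε 0<ε →
          let N , f = y-lim ε 0<ε
          in N , λ n p → ∣∣-resp (solve 2 (λ a s → (a :+ s) :* (a :- s) := a :* a :- s :* s) (y n) S) refl
               (∣∣-* (∣∣-+ (∣y∣ n) ∣S∣) (∣∣<⇒≤ (f n p)))
        fixed : S + S ≈ q + S * S
        fixed = lim-unique (lim-resp 2y refl (lim-+ (lim-shift 1 y-lim) (lim-shift 1 y-lim)))
                           (lim-+ (lim-const q) y²-lim)
        0<r : 0# < 1# - S
        0<r = 0<- (≤-<-trans (∣∣-≤ ∣S∣) q<1)
        r² : (1# - S) * (1# - S) ≈ 1# - q
        r² = trans (solve 1 (λ s → (:1 :- s) :* (:1 :- s) := (:1 :- (s :+ s)) :+ s :* s) S)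
          (trans (+-congʳ (+-congˡ (-‿cong fixed))) (solve 2 (λ q t → (:1 :- (q :+ t)) :+ t := :1 :- q) q (S * S)))

    √[1-q] : Carrier
    √[1-q] = proj₁ √[1-q]-exists

    abstract
      0<√[1-q] : 0# < √[1-q]
      0<√[1-q] = proj₁ (proj₂ √[1-q]-exists)

      √[1-q]#0 : √[1-q] # 0#
      √[1-q]#0 = 0<⇒#0 0<√[1-q]

    ν : Carrier
    ν = 1# ÷ √[1-q] [ √[1-q]#0 ]

    -- Jackson integrals of an integrand f; the proof arguments say that the
    -- defining series converge.

    JacksonTerm : (Carrier → Carrier) → Carrier → ℕ → Carrier
    JacksonTerm f b m = q ^ m * f (q ^ m * b)

    JacksonSummable : (Carrier → Carrier) → Carrier → Set (c ⊔ ℓ₃)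
    JacksonSummable f b = Summable (JacksonTerm f b)

    ∫₀ : ∀ b f → JacksonSummable f b → Carrier
    ∫₀ b f h = (1# - q) * b * ∑∞ (JacksonTerm f b) h

    ∫ : ∀ a b f → JacksonSummable f a × JacksonSummable f b → Carrier
    ∫ a b f (ha , hb) = ∫₀ b f hb - ∫₀ a f ha

    integrand : ℕ → ℕ → Carrier → Carrier
    integrand n s x = x ^ (2 ℕ.* n) * H s x ^ 2 * wG x

    Bounded : (Carrier → Carrier) → Set (c ⊔ ℓ₃)
    Bounded g = ∃ λ K → ∀ x → ∣ x ∣≤ ν → ∣ g x ∣≤ K

    abstract
      0<ν : 0# < ν
      0<ν = ÷-pos √[1-q]#0 0<1 0<√[1-q]

      ν² : ν * ν * (1# - q) ≈ 1#
      ν² = begin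
        ν * ν * (1# - q)                 ≈⟨ *-congˡ (proj₂ (proj₂ √[1-q]-exists)) ⟨
        ν * ν * (√[1-q] * √[1-q])        ≈⟨ solve 2 (λ n r → n :* n :* (r :* r) := (n :* r) :* (n :* r)) ν √[1-q] ⟩
        (ν * √[1-q]) * (ν * √[1-q])      ≈⟨ *-cong (÷-* 1# √[1-q] √[1-q]#0) (÷-* 1# √[1-q] √[1-q]#0) ⟩
        1# * 1#                          ≈⟨ *-identityʳ 1# ⟩
        1#                               ∎

      bounded-const : ∀ k → Bounded (λ _ → k)
      bounded-const k = let K , h = archimedean-∣∣ k in K , λ _ _ → h

      bounded-id : Bounded (λ x → x)
      bounded-id = ν , λ _ h → h

      bounded-* : ∀ {f g} → Bounded f → Bounded g → Bounded (λ x → f x * g x)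
      bounded-* (K , h) (L , k) = K * L , λ x b → ∣∣-* (h x b) (k x b)

      bounded-minus : ∀ {f g} → Bounded f → Bounded g → Bounded (λ x → f x - g x)
      bounded-minus (K , h) (L , k) = K + L , λ x b → ∣∣-+ (h x b) (∣∣-neg (k x b))

      bounded-^ : ∀ {f} n → Bounded f → Bounded (λ x → f x ^ n)
      bounded-^ n (K , h) = K ^ n , λ x b → ∣∣-^ (h x b) n

      bounded-H : ∀ s → Bounded (H s)
      bounded-H zero          = bounded-const 1#
      bounded-H (suc zero)    = bounded-id
      bounded-H (suc (suc s)) = bounded-minus (bounded-* bounded-id (bounded-H (suc s)))
                                          (bounded-* (bounded-const (q ^ s * qint (suc s))) (bounded-H s))

      bounded-wG : Bounded wG
      bounded-wG =
        let A , h = bounded-* (bounded-const (- (q ^ 2))) (bounded-* (bounded-^ 2 bounded-id) (bounded-const (proj₁ (#⇒invertible (qint#0 1)))))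
            B , k = Base².E-bound (∣∣-bound (h ν (∣∣-nonneg (<⇒≤ 0<ν))))
        in B , λ x b → k _ (∣∣-resp (solve 3 (λ y x i → :- y :* (x :* i) := :- (y :* x) :* i) (q ^ 2) (x ^ 2) _) refl (h x b))

      jackson-summable : ∀ {f b} → Bounded f → ∣ b ∣≤ ν → JacksonSummable f b
      jackson-summable {f} {b} (K , h) hb = compare {b = λ m → K * q ^ m}
        (λ m → ∣∣-resp refl (*-comm (q ^ m) K) (∣∣-* (∣q^∣ m)
          (h (q ^ m * b) (∣∣-resp refl (*-identityˡ ν) (∣∣-* (∣∣-mono (^≤1 (<⇒≤ 0<q) (<⇒≤ q<1) m) (∣q^∣ m)) hb)))))
        (summable-* {q ^_} K (geometric 0<q q<1))

      jackson-summable-±ν : ∀ {f} → Bounded f → JacksonSummable f (- ν) × JacksonSummable f ν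
      jackson-summable-±ν h = jackson-summable h (∣∣-neg ∣ν∣) , jackson-summable h ∣ν∣
        where
        ∣ν∣ : ∣ ν ∣≤ ν
        ∣ν∣ = ∣∣-nonneg (<⇒≤ 0<ν)

      wG-integrable : JacksonSummable wG (- ν) × JacksonSummable wG ν
      wG-integrable = jackson-summable-±ν bounded-wG

      integrand-integrable : ∀ n s → JacksonSummable (integrand n s) (- ν) × JacksonSummable (integrand n s) ν
      integrand-integrable n s = jackson-summable-±ν
        (bounded-* (bounded-* (bounded-^ (2 ℕ.* n) bounded-id) (bounded-^ 2 (bounded-H s))) bounded-wG)

    c[q] : Carrier
    c[q] = ∫ (- ν) ν wG wG-integrable

    abstract
      wG-pos : ∀ {b} → b * b * (1# - q) ≈ 1# → ∀ m → 0# < wG (q ^ m * b)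
      wG-pos {b} hb m = Base².E-pos z z≤0 (<-respʳ (+-congˡ (sym kz)) (<-resp refl (solve 2 (λ y t → :1 :- y :* :1 :* (t :* :1) := :1 :+ :- (y :* :1 :* (t :* :1))) (q * q) (q ^ m * q ^ m)) (0<- q²q²ᵐ<1)))
        where
        x : Carrier
        x = q ^ m * b
        z : Carrier
        z = - (q ^ 2 * x ^ 2) ÷ qint 2 [ qint#0 1 ]
        z* : z * qint 2 ≈ - (q ^ 2 * x ^ 2)
        z* = ÷-* (- (q ^ 2 * x ^ 2)) (qint 2) (qint#0 1)
        z≤0 : z ≤ 0#
        z≤0 0<z = *-nonneg (square-nonneg q) (square-nonneg x)
          (<-resp (solve 2 (λ y x → :- :- (y :* (y :* :1) :* (x :* (x :* :1))) := y :* y :* (x :* x)) q x) refl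
            (lt (*-pos 0<z (<-≤-trans 0<1 (1≤qint 1))) (trans (+-identityˡ _) (trans (-‿cong (-‿cong (sym z*))) (solve 1 (λ z → :- :- z := z) _)))))
        kz : (1# - q ^ 2) * z ≈ - (q * q * 1# * (q ^ m * q ^ m * 1#))
        kz = begin
          (1# - q ^ 2) * z                              ≈⟨ *-congʳ (÷-* (1# - q ^ 2) (1# - q) 1-q#0) ⟨
          qint 2 * (1# - q) * z                         ≈⟨ solve 3 (λ i y z → i :* y :* z := y :* (z :* i)) (qint 2) (1# - q) z ⟩
          (1# - q) * (z * qint 2)                       ≈⟨ *-congˡ z* ⟩
          (1# - q) * - (q ^ 2 * x ^ 2)                  ≈⟨ solve 3 (λ q t b → (:1 :- q) :* :- (q :* (q :* :1) :* (t :* b :* (t :* b :* :1))) := :- (q :* q :* :1 :* (t :* t :* (b :* b :* (:1 :- q))))) q (q ^ m) b ⟩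
          - (q * q * 1# * (q ^ m * q ^ m * (b * b * (1# - q))))  ≈⟨ -‿cong (*-congˡ (*-congˡ hb)) ⟩
          - (q * q * 1# * (q ^ m * q ^ m * 1#))         ∎
        q^m≤1 : q ^ m ≤ 1#
        q^m≤1 = ^≤1 (<⇒≤ 0<q) (<⇒≤ q<1) m
        0≤q^m : 0# ≤ q ^ m
        0≤q^m = <⇒≤ (^-pos 0<q m)
        q²q²ᵐ<1 : q * q * 1# * (q ^ m * q ^ m * 1#) < 1#
        q²q²ᵐ<1 = ≤-<-trans
          (≤-resp refl (solve 1 (λ q → q :* q :* :1 :* (:1 :* :1 :* :1) := q :* (q :* :1)) q)
            (*-monoˡ-≤ (*-nonneg (square-nonneg q) 0≤1) (*-monoʳ-≤ 0≤1 (*-mono-≤ 0≤q^m 0≤1 q^m≤1 q^m≤1))))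
          q²<1

      c[q]-pos : 0# < c[q]
      c[q]-pos = <-resp refl (solve 4 (λ y n s t → y :* n :* s :+ y :* n :* t := y :* n :* s :- y :* :- n :* t) (1# - q) ν _ _)
        (+-pos (*-pos (*-pos 0<1-q 0<ν) (positive ν ν² (proj₂ wG-integrable)))
               (*-pos (*-pos 0<1-q 0<ν) (positive (- ν) (trans (*-congʳ (solve 1 (λ n → :- n :* :- n := n :* n) ν)) ν²) (proj₁ wG-integrable))))
        where
        positive : ∀ b → b * b * (1# - q) ≈ 1# → (h : JacksonSummable wG b) → 0# < ∑∞ (JacksonTerm wG b) h
        positive b hb (_ , h) = sumsTo-pos {JacksonTerm wG b} (λ m → *-pos (^-pos 0<q m) (wG-pos hb m)) h

      c[q]#0 : c[q] # 0#
      c[q]#0 = 0<⇒#0 c[q]-pos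

    f : ℕ → ℕ → Carrier
    f n s = (1# ÷ c[q] [ c[q]#0 ]) * ∫ (- ν) ν (integrand n s) (integrand-integrable n s)

{-# OPTIONS --safe #-}
module Submission where

-- Expanding H_s = x H_{s-1} - a_{s-1} H_{s-2} with a_k = q^{k-1}[k]_q, the square H_s² yields
-- the two outer terms and the cross term x H_{s-1} H_{s-2}; the mean y_s of x^{2n} times the
-- cross term satisfies y_{s+1} = f(n+1, s+1) - a_{s+1} y_s, whose solution is the alternating sum
-- since a_1 ⋯ a_s = q^{s choose 2} [s]_q!.  The moments come from q-integration by parts: the
-- functional equation w_G(x) = (1 - (1-q) (qx)²) w_G(qx) makes the terms of
-- Σ (1 - (1-q) x²) x^{2n} w_G(x) at x = q^m ν a shift of those of q^{2n+1} Σ x^{2n} w_G(x).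

open import Data.Fin.Base using (Fin; toℕ)
open import Data.Fin.Properties using (toℕ<n)
open import Data.Nat.Base as ℕ using (ℕ; zero; suc; _∸_)
open import Data.Nat.Combinatorics using (_C_)
import Data.Nat.Properties as ℕₚ
open import Data.Product.Base using (_×_; _,_; proj₁; proj₂)
open import Level using (Level; _⊔_)
import Algebra.Properties.Monoid.Sum as MonoidSum
import Relation.Binary.PropositionalEquality.Core as ≡
open import Defs

module GaussianMoments {c ℓ₁ ℓ₂ ℓ₃ : Level} (ℝ : RealField c ℓ₁ ℓ₂ ℓ₃) where
  open QHermite ℝ

  -- Signs, and the solution of an alternating first-order recurrence.

  minus-one-square : ∀ n → (- 1#) ^ n * (- 1#) ^ n ≈ 1#
  minus-one-square zero    = *-identityˡ 1#
  minus-one-square (suc n) = trans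
    (solve 1 (λ z → (:- :1 :* z) :* (:- :1 :* z) := z :* z) ((- 1#) ^ n)) (minus-one-square n)

  -- `(- 1#) ^ m` is its own inverse, so inserting its square replaces a division. The factor
  -- depending on `n` alone can then leave a sum over `m`.
  minus-one-∸ : ∀ {m n} → m ℕ.≤ n → (- 1#) ^ (n ∸ m) ≈ (- 1#) ^ n * (- 1#) ^ m
  minus-one-∸ {m} {n} m≤n = begin
    (- 1#) ^ (n ∸ m)                                  ≈⟨ *-identityʳ _ ⟨
    (- 1#) ^ (n ∸ m) * 1#                             ≈⟨ *-congˡ (minus-one-square m) ⟨
    (- 1#) ^ (n ∸ m) * ((- 1#) ^ m * (- 1#) ^ m)      ≈⟨ *-assoc _ _ _ ⟨
    (- 1#) ^ (n ∸ m) * (- 1#) ^ m * (- 1#) ^ m        ≈⟨ *-congʳ (^-homo-* (- 1#) (n ∸ m) m) ⟨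
    (- 1#) ^ (n ∸ m ℕ.+ m) * (- 1#) ^ m               ≡⟨ ≡.cong (λ k → (- 1#) ^ k * (- 1#) ^ m) (ℕₚ.m∸n+n≡m m≤n) ⟩
    (- 1#) ^ n * (- 1#) ^ m                           ∎

  -- `partialSum` unfolds at its first term, while the recurrence for `y` appends terms at the end.
  partialSum-last : ∀ a n → partialSum a (suc n) ≈ partialSum a n + a n
  partialSum-last a zero    = +-comm (a 0) 0#
  partialSum-last a (suc n) = trans (+-congˡ (partialSum-last (λ i → a (suc i)) n)) (sym (+-assoc _ _ _))

  -- Variation of constants: `y s` divided by `(- 1#) ^ s * P s` grows by exactly `u (suc s)` at
  -- each step. The sequence `u` is given through `P l * u l`, which avoids division here.
  alternating-solution : ∀ (α P u φ y : ℕ → Carrier) → (∀ s → P (suc s) ≈ α s * P s) →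
    (∀ l → P l * u l ≈ (- 1#) ^ l * φ l) →
    y 0 ≈ φ 0 → (∀ s → y (suc s) ≈ φ (suc s) - α s * y s) →
    ∀ s → y s ≈ (- 1#) ^ s * (P s * partialSum u (suc s))
  alternating-solution α P u φ y P₊ Pu y₀ y₊ zero = begin
    y 0                              ≈⟨ y₀ ⟩
    φ 0                              ≈⟨ *-identityˡ (φ 0) ⟨
    1# * φ 0                         ≈⟨ Pu 0 ⟨
    P 0 * u 0                        ≈⟨ solve 2 (λ p u → p :* u := :1 :* (p :* (u :+ :0))) (P 0) (u 0) ⟩
    1# * (P 0 * (u 0 + 0#))          ∎
  alternating-solution α P u φ y P₊ Pu y₀ y₊ (suc s) = begin
    y (suc s)                                               ≈⟨ y₊ s ⟩
    -- `ε` unfolds to `- 1# * σ`, which absorbs the minus sign of the recurrence.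
    φ (suc s) - α s * y s                                   ≈⟨ +-cong φ≈ (-‿cong (*-congˡ (alternating-solution α P u φ y P₊ Pu y₀ y₊ s))) ⟩
    ε * (P (suc s) * u (suc s)) - α s * (σ * (P s * S))     ≈⟨ solve 5 (λ t w a z p → t :- a :* (z :* (p :* w)) := t :+ :- :1 :* z :* (a :* p :* w)) _ S (α s) σ (P s) ⟩
    ε * (P (suc s) * u (suc s)) + ε * (α s * P s * S)       ≈⟨ +-congˡ (*-congˡ (*-congʳ (P₊ s))) ⟨
    ε * (P (suc s) * u (suc s)) + ε * (P (suc s) * S)       ≈⟨ solve 4 (λ e p u w → e :* (p :* u) :+ e :* (p :* w) := e :* (p :* (w :+ u))) ε (P (suc s)) (u (suc s)) S ⟩
    ε * (P (suc s) * (S + u (suc s)))                       ≈⟨ *-congˡ (*-congˡ (partialSum-last u (suc s))) ⟨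
    ε * (P (suc s) * partialSum u (suc (suc s)))            ∎
    where
    σ ε S : Carrier
    σ = (- 1#) ^ s
    ε = (- 1#) ^ suc s
    S = partialSum u (suc s)
    φ≈ : φ (suc s) ≈ ε * (P (suc s) * u (suc s))
    φ≈ = begin
      φ (suc s)                          ≈⟨ *-identityˡ _ ⟨
      1# * φ (suc s)                     ≈⟨ *-congʳ (minus-one-square (suc s)) ⟨
      ε * ε * φ (suc s)                  ≈⟨ *-assoc _ _ _ ⟩
      ε * (ε * φ (suc s))                ≈⟨ *-congˡ (Pu (suc s)) ⟨
      ε * (P (suc s) * u (suc s))        ∎

  module Means (q : Carrier) (0<q : 0# < q) (q<1 : q < 1#) where
    open Gaussian q 0<q q<1

    -- The functional equation of the Gaussian weight and the moment recurrence.

    wG-cong : ∀ {x y} → x ≈ y → wG x ≈ wG y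
    wG-cong e = Base².E-cong (*-congʳ (-‿cong (*-congˡ (^-congˡ 2 e))))

    -- This is the functional equation of the exponential to base `q ^ 2`: since `qint 2 * (1# - q)`
    -- is `1# - q ^ 2`, the denominator of `z` cancels, and scaling `z` by `q ^ 2` amounts to
    -- scaling `x` by `q`.
    wG-functional : ∀ x → wG x ≈ (1# - (1# - q) * ((q * x) * (q * x))) * wG (q * x)
    wG-functional x = trans (Base².E-functional z) (*-cong factor (Base².E-cong scaled))
      where
      i z : Carrier
      i = proj₁ (#⇒invertible (qint#0 1))
      z = - (q ^ 2 * x ^ 2) ÷ qint 2 [ qint#0 1 ]
      factor : 1# + (1# - q ^ 2) * z ≈ 1# - (1# - q) * ((q * x) * (q * x))
      factor = begin
        1# + (1# - q ^ 2) * z                       ≈⟨ +-congˡ (*-congʳ (÷-* (1# - q ^ 2) (1# - q) 1-q#0)) ⟨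
        1# + qint 2 * (1# - q) * z                  ≈⟨ solve 3 (λ j y z → :1 :+ j :* y :* z := :1 :+ y :* (z :* j)) (qint 2) (1# - q) z ⟩
        1# + (1# - q) * (z * qint 2)                ≈⟨ +-congˡ (*-congˡ (÷-* (- (q ^ 2 * x ^ 2)) (qint 2) (qint#0 1))) ⟩
        1# + (1# - q) * - (q ^ 2 * x ^ 2)           ≈⟨ solve 2 (λ q x → :1 :+ (:1 :- q) :* :- (q :* (q :* :1) :* (x :* (x :* :1))) := :1 :- (:1 :- q) :* ((q :* x) :* (q :* x))) q x ⟩
        1# - (1# - q) * ((q * x) * (q * x))         ∎
      scaled : q ^ 2 * z ≈ - (q ^ 2 * (q * x) ^ 2) ÷ qint 2 [ qint#0 1 ]
      scaled = solve 3 (λ q x i → q :* (q :* :1) :* (:- (q :* (q :* :1) :* (x :* (x :* :1))) :* i)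
                               := :- (q :* (q :* :1) :* (q :* x :* (q :* x :* :1))) :* i) q x i

    x^2[1+n] : ∀ x n → x ^ (2 ℕ.* suc n) ≈ x * (x * x ^ (2 ℕ.* n))
    x^2[1+n] x n = reflexive (≡.cong (x ^_) (ℕₚ.*-suc 2 n))

    -- The endpoints are those b at which the first term of Σ (1 - (1-q) x²) x^{2n} w_G(x) vanishes.
    jackson-moment-suc : ∀ n {b A B} → b * b * (1# - q) ≈ 1# →
      JacksonTerm (integrand n 0) b sumsTo A → JacksonTerm (integrand (suc n) 0) b sumsTo B →
      B ≈ qint (2 ℕ.* n ℕ.+ 1) * A
    jackson-moment-suc n {b} {A} {B} hb hA hB = *-cancelʳ (1# - q) 1-q#0 (begin
      -- The padding `0# + 0#` has the shape of `partialSum d 1` with `d 0` replaced by zero, which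
      -- prepares dropping the first term of `d`.
      B * (1# - q)                                     ≈⟨ solve 3 (λ A B k → B :* k := A :- (A :+ :- k :* B :- (:0 :+ :0))) A B (1# - q) ⟩
      A - (A + - (1# - q) * B - (0# + 0#))             ≈⟨ +-congˡ (-‿cong (+-congˡ (-‿cong (+-congʳ (sym d-zero))))) ⟩
      A - (A + - (1# - q) * B - partialSum d 1)        ≈⟨ +-congˡ (-‿cong (sumsTo-unique {λ m → q ^ k * a m}
                                                            (sumsTo-resp {λ m → d (1 ℕ.+ m)} d-suc refl (sumsTo-drop {d} 1 d-sums))
                                                            (sumsTo-* {a} (q ^ k) hA))) ⟩
      A - q ^ k * A                                    ≈⟨ solve 2 (λ z A → A :- z :* A := (:1 :- z) :* A) (q ^ k) A ⟩
      (1# - q ^ k) * A                                 ≈⟨ *-congʳ (÷-* (1# - q ^ k) (1# - q) 1-q#0) ⟨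
      qint k * (1# - q) * A                            ≈⟨ solve 3 (λ i y A → i :* y :* A := i :* A :* y) (qint k) (1# - q) A ⟩
      qint k * A * (1# - q)                            ∎)
      where
      k : ℕ
      k = 2 ℕ.* n ℕ.+ 1
      a a′ d : ℕ → Carrier
      a = JacksonTerm (integrand n 0) b
      a′ = JacksonTerm (integrand (suc n) 0) b
      d m = a m + - (1# - q) * a′ m
      d-sums : d sumsTo (A + - (1# - q) * B)
      d-sums = sumsTo-+ {a} {λ m → - (1# - q) * a′ m} hA (sumsTo-* {a′} (- (1# - q)) hB)
      d-factor : ∀ m → d m ≈ (1# - (1# - q) * ((q ^ m * b) * (q ^ m * b))) * a m
      d-factor m = begin
        a m + - (1# - q) * a′ m
          ≈⟨ +-congˡ (*-congˡ (*-congˡ (*-congʳ (*-congʳ (x^2[1+n] x n))))) ⟩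
        a m + - (1# - q) * (q ^ m * (x * (x * x ^ (2 ℕ.* n)) * 1# ^ 2 * wG x))
          ≈⟨ solve 5 (λ y z x p w → z :* (p :* (:1 :* (:1 :* :1)) :* w) :+ :- y :* (z :* (x :* (x :* p) :* (:1 :* (:1 :* :1)) :* w))
                                := (:1 :- y :* (x :* x)) :* (z :* (p :* (:1 :* (:1 :* :1)) :* w))) (1# - q) (q ^ m) x (x ^ (2 ℕ.* n)) (wG x) ⟩
        (1# - (1# - q) * (x * x)) * a m  ∎
        where
        x : Carrier
        x = q ^ m * b
      d-zero : d 0 ≈ 0#
      d-zero = begin
        d 0                                                    ≈⟨ d-factor 0 ⟩
        (1# - (1# - q) * ((1# * b) * (1# * b))) * a 0          ≈⟨ *-congʳ (solve 2 (λ y b → :1 :- y :* ((:1 :* b) :* (:1 :* b)) := :1 :- b :* b :* y) (1# - q) b) ⟩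
        (1# - b * b * (1# - q)) * a 0                          ≈⟨ *-congʳ (+-congˡ (-‿cong hb)) ⟩
        (1# - 1#) * a 0                                        ≈⟨ solve 1 (λ a → (:1 :- :1) :* a := :0) (a 0) ⟩
        0#                                                     ∎
      -- The polynomial factor at `q * x` is the one that `wG-functional` absorbs into `wG x`; the
      -- powers of `q` left over, from the Jackson weight and from `x ^ (2 ℕ.* n)`, make up `q ^ k`.
      d-suc : ∀ m → d (suc m) ≈ q ^ k * a m
      d-suc m = begin
        d (suc m)
          ≈⟨ d-factor (suc m) ⟩
        (1# - (1# - q) * (x′ * x′)) * (q ^ suc m * (x′ ^ (2 ℕ.* n) * 1# ^ 2 * wG x′))
          ≈⟨ *-cong (+-congˡ (-‿cong (*-congˡ (*-cong x′≈ x′≈)))) (*-congˡ (*-cong (*-congʳ (trans (^-congˡ (2 ℕ.* n) x′≈) (^-distrib-* q x (2 ℕ.* n)))) (wG-cong x′≈))) ⟩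
        (1# - (1# - q) * ((q * x) * (q * x))) * (q * q ^ m * (q ^ (2 ℕ.* n) * x ^ (2 ℕ.* n) * 1# ^ 2 * wG (q * x)))
          ≈⟨ solve 6 (λ t q z r p w → t :* (q :* z :* (r :* p :* (:1 :* (:1 :* :1)) :* w)) := r :* (q :* :1) :* (z :* (p :* (:1 :* (:1 :* :1)) :* (t :* w))))
               _ q (q ^ m) (q ^ (2 ℕ.* n)) (x ^ (2 ℕ.* n)) (wG (q * x)) ⟩
        q ^ (2 ℕ.* n) * q ^ 1 * (q ^ m * (x ^ (2 ℕ.* n) * 1# ^ 2 * ((1# - (1# - q) * ((q * x) * (q * x))) * wG (q * x))))
          ≈⟨ *-cong (^-homo-* q (2 ℕ.* n) 1) (*-congˡ (*-congˡ (wG-functional x))) ⟨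
        q ^ k * a m ∎
        where
        x x′ : Carrier
        x = q ^ m * b
        x′ = q ^ suc m * b
        x′≈ : x′ ≈ q * x
        x′≈ = *-assoc q (q ^ m) b

    -- Linearity of the normalised Jackson integral.

    record HasMean (g : Carrier → Carrier) (I : Carrier) : Set (c ⊔ ℓ₁ ⊔ ℓ₃) where
      constructor hasMean
      field
        integrable : JacksonSummable g (- ν) × JacksonSummable g ν
        mean-value : (1# ÷ c[q] [ c[q]#0 ]) * ∫ (- ν) ν g integrable ≈ I

    mean-f : ∀ n s → HasMean (integrand n s) (f n s)
    mean-f n s = hasMean (integrand-integrable n s) refl

    -- Limits are unique, so a mean does not depend on the convergence proof its integral carries.
    -- Pointwise identities of integrands thereby become identities between values of `f` and
    -- `crossMean`.
    mean-unique : ∀ {g h I J} → (∀ x → g x ≈ h x) → HasMean g I → HasMean h J → I ≈ J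
    mean-unique {g} {h} e (hasMean ((S , hS) , (T , hT)) i) (hasMean ((S′ , hS′) , (T′ , hT′)) j) =
      trans (sym i) (trans (*-congˡ (+-cong (*-congˡ (same ν hT hT′)) (-‿cong (*-congˡ (same (- ν) hS hS′))))) j)
      where
      same : ∀ b {A B} → JacksonTerm g b sumsTo A → JacksonTerm h b sumsTo B → A ≈ B
      same b hA hB = sumsTo-unique {JacksonTerm h b} (sumsTo-resp {JacksonTerm g b} (λ m → *-congˡ (e (q ^ m * b))) refl hA) hB

    mean-+ : ∀ {g h I J} → HasMean g I → HasMean h J → HasMean (λ x → g x + h x) (I + J)
    mean-+ {g} {h} (hasMean ((S , hS) , (T , hT)) i) (hasMean ((S′ , hS′) , (T′ , hT′)) j) =
      hasMean ((S + S′ , add (- ν) hS hS′) , (T + T′ , add ν hT hT′)) (trans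
        (solve 8 (λ k l y n S T S′ T′ → k :* (y :* (T :+ T′) :- l :* (S :+ S′)) := k :* (y :* T :- l :* S) :+ k :* (y :* T′ :- l :* S′))
              _ _ _ ν S T S′ T′) (+-cong i j))
      where
      add : ∀ b {A B} → JacksonTerm g b sumsTo A → JacksonTerm h b sumsTo B → JacksonTerm (λ x → g x + h x) b sumsTo (A + B)
      add b hA hB = sumsTo-resp {λ m → JacksonTerm g b m + JacksonTerm h b m} (λ m → sym (distribˡ (q ^ m) _ _)) refl
        (sumsTo-+ {JacksonTerm g b} {JacksonTerm h b} hA hB)

    mean-* : ∀ {g I} k → HasMean g I → HasMean (λ x → k * g x) (k * I)
    mean-* {g} k (hasMean ((S , hS) , (T , hT)) i) =
      hasMean ((k * S , mul (- ν) hS) , (k * T , mul ν hT)) (trans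
        (solve 6 (λ k j y l S T → j :* (y :* (k :* T) :- l :* (k :* S)) := k :* (j :* (y :* T :- l :* S))) k _ _ _ S T) (*-congˡ i))
      where
      mul : ∀ b {A} → JacksonTerm g b sumsTo A → JacksonTerm (λ x → k * g x) b sumsTo (k * A)
      mul b hA = sumsTo-resp {λ m → k * JacksonTerm g b m} (λ m → solve 3 (λ k z g → k :* (z :* g) := z :* (k :* g)) k (q ^ m) _) refl
        (sumsTo-* {JacksonTerm g b} k hA)

    -- Initial values: the columns `s = 0` and `s = 1`.

    f-zero-zero : f 0 0 ≈ 1#
    f-zero-zero = mean-unique (λ x → solve 1 (λ w → :1 :* (:1 :* (:1 :* :1)) :* w := w) (wG x)) (mean-f 0 0)
      -- With this convergence proof the integral of `wG` is `c[q]` by definition.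
      (hasMean wG-integrable (÷-* 1# c[q] c[q]#0))

    -- Both endpoints square to the inverse of `1# - q`, so the moment step applies to each Jackson
    -- series and the common factor leaves their difference.
    f-suc-zero : ∀ n → f (suc n) 0 ≈ qint (2 ℕ.* n ℕ.+ 1) * f n 0
    f-suc-zero n = trans
      (*-congˡ (+-cong (*-congˡ (jackson-moment-suc n ν² (proj₂ (proj₂ hA)) (proj₂ (proj₂ hB))))
                       (-‿cong (*-congˡ (jackson-moment-suc n -ν² (proj₂ (proj₁ hA)) (proj₂ (proj₁ hB)))))))
      (solve 6 (λ k j y l S T → j :* (y :* (k :* T) :- l :* (k :* S)) := k :* (j :* (y :* T :- l :* S))) (qint (2 ℕ.* n ℕ.+ 1)) _ _ _ _ _)
      where
      hA = integrand-integrable n 0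
      hB = integrand-integrable (suc n) 0
      -ν² : - ν * - ν * (1# - q) ≈ 1#
      -ν² = trans (*-congʳ (solve 1 (λ n → :- n :* :- n := n :* n) ν)) ν²

    f-zero : ∀ n → f n 0 ≈ oddfact n
    f-zero zero    = f-zero-zero
    f-zero (suc n) = trans (f-suc-zero n) (*-congˡ (f-zero n))

    f-one : ∀ n → f n 1 ≈ oddfact (suc n)
    f-one n = trans (mean-unique square (mean-f n 1) (mean-f (suc n) 0)) (f-zero (suc n))
      where
      square : ∀ x → integrand n 1 x ≈ integrand (suc n) 0 x
      square x = trans (solve 3 (λ x p w → p :* (x :* (x :* :1)) :* w := x :* (x :* p) :* (:1 :* (:1 :* :1)) :* w) x (x ^ (2 ℕ.* n)) (wG x))
        (*-congʳ (*-congʳ (sym (x^2[1+n] x n))))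

    -- The cross term of the squared recurrence.

    crossTerm : ℕ → ℕ → Carrier → Carrier
    crossTerm n s x = x ^ (2 ℕ.* n) * (x * H (suc s) x * H s x) * wG x

    crossTerm-integrable : ∀ n s → JacksonSummable (crossTerm n s) (- ν) × JacksonSummable (crossTerm n s) ν
    crossTerm-integrable n s = jackson-summable-±ν (bounded-* (bounded-* (bounded-^ (2 ℕ.* n) bounded-id)
      (bounded-* (bounded-* bounded-id (bounded-H (suc s))) (bounded-H s))) bounded-wG)

    crossMean : ℕ → ℕ → Carrier
    crossMean n s = (1# ÷ c[q] [ c[q]#0 ]) * ∫ (- ν) ν (crossTerm n s) (crossTerm-integrable n s)

    mean-cross : ∀ n s → HasMean (crossTerm n s) (crossMean n s)
    mean-cross n s = hasMean (crossTerm-integrable n s) refl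

    -- The index is shifted: `recCoeff s` is a_{s+1}, the coefficient of `H s` in the recurrence for
    -- `H (suc (suc s))`.
    recCoeff : ℕ → Carrier
    recCoeff s = q ^ s * qint (suc s)

    crossMean-zero : ∀ n → crossMean n 0 ≈ f (suc n) 0
    crossMean-zero n = mean-unique same (mean-cross n 0) (mean-f (suc n) 0)
      where
      same : ∀ x → crossTerm n 0 x ≈ integrand (suc n) 0 x
      same x = trans (solve 3 (λ x p w → p :* (x :* x :* :1) :* w := x :* (x :* p) :* (:1 :* (:1 :* :1)) :* w) x (x ^ (2 ℕ.* n)) (wG x))
        (*-congʳ (*-congʳ (sym (x^2[1+n] x n))))

    -- Only the higher of the two Hermite factors is expanded: its leading part gives x² H_{s+1}²,
    -- whose x² raises `n` by one, and the rest is a multiple of the previous cross term.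
    crossMean-suc : ∀ n s → crossMean n (suc s) ≈ f (suc n) (suc s) - recCoeff s * crossMean n s
    crossMean-suc n s = trans
      (mean-unique expand (mean-cross n (suc s)) (mean-+ (mean-f (suc n) (suc s)) (mean-* (- recCoeff s) (mean-cross n s))))
      (solve 3 (λ φ a y → φ :+ :- a :* y := φ :- a :* y) _ (recCoeff s) _)
      where
      expand : ∀ x → crossTerm n (suc s) x ≈ integrand (suc n) (suc s) x + - recCoeff s * crossTerm n s x
      expand x = trans
        (solve 6 (λ x p w a h₁ h₀ → p :* (x :* (x :* h₁ :- a :* h₀) :* h₁) :* w
                                  := x :* (x :* p) :* (h₁ :* (h₁ :* :1)) :* w :+ :- a :* (p :* (x :* h₁ :* h₀) :* w))
          x (x ^ (2 ℕ.* n)) (wG x) (recCoeff s) (H (suc s) x) (H s x))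
        (+-congʳ (*-congʳ (*-congʳ (sym (x^2[1+n] x n)))))

    -- The square of x H_{s+1} - a_{s+1} H_s is multiplied out. The right side is written with `+ -`
    -- to match the form that `mean-+` and `mean-*` produce.
    f-suc-suc : ∀ n s → f n (suc (suc s)) ≈
      f (suc n) (suc s) + - (recCoeff s + recCoeff s) * crossMean n s + recCoeff s ^ 2 * f n s
    f-suc-suc n s = mean-unique expand (mean-f n (suc (suc s)))
      (mean-+ (mean-+ (mean-f (suc n) (suc s)) (mean-* (- (recCoeff s + recCoeff s)) (mean-cross n s))) (mean-* (recCoeff s ^ 2) (mean-f n s)))
      where
      expand : ∀ x → integrand n (suc (suc s)) x ≈
        integrand (suc n) (suc s) x + - (recCoeff s + recCoeff s) * crossTerm n s x + recCoeff s ^ 2 * integrand n s x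
      expand x = trans
        (solve 6 (λ x p w a h₁ h₀ → p :* ((x :* h₁ :- a :* h₀) :* ((x :* h₁ :- a :* h₀) :* :1)) :* w
                                  := x :* (x :* p) :* (h₁ :* (h₁ :* :1)) :* w :+ :- (a :+ a) :* (p :* (x :* h₁ :* h₀) :* w)
                                     :+ a :* (a :* :1) :* (p :* (h₀ :* (h₀ :* :1)) :* w))
          x (x ^ (2 ℕ.* n)) (wG x) (recCoeff s) (H (suc s) x) (H s x))
        (+-congʳ (+-congʳ (*-congʳ (*-congʳ (sym (x^2[1+n] x n))))))

    -- Closed form of the cross mean.

    coeffProduct : ℕ → Carrier
    coeffProduct s = q ^ (s C 2) * qfact s

    -- Pascal's rule adds `s` to the exponent `s C 2`, so `coeffProduct s` is the product of the
    -- first `s` values of `recCoeff`.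
    coeffProduct-suc : ∀ s → coeffProduct (suc s) ≈ recCoeff s * coeffProduct s
    coeffProduct-suc s = trans (*-congʳ (^-C-suc s))
      (solve 4 (λ a b f i → a :* b :* (f :* i) := a :* i :* (b :* f)) (q ^ s) (q ^ (s C 2)) (qfact s) (qint (suc s)))

    -- This is the very factor by which `_÷_[_]` multiplies in the stated sum, so the ring solver
    -- can treat both as one atom.
    coeffProduct⁻¹ : ℕ → Carrier
    coeffProduct⁻¹ l = proj₁ (#⇒invertible (^*qfact#0 (l C 2) l))

    alternatingTerm : ℕ → ℕ → Carrier
    alternatingTerm n l = (- 1#) ^ l * coeffProduct⁻¹ l * f (suc n) l

    crossMean-sum : ∀ n s → crossMean n s ≈ (- 1#) ^ s * (coeffProduct s * partialSum (alternatingTerm n) (suc s))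
    crossMean-sum n = alternating-solution recCoeff coeffProduct (alternatingTerm n) (f (suc n)) (crossMean n)
      coeffProduct-suc cancel (crossMean-zero n) (crossMean-suc n)
      where
      cancel : ∀ l → coeffProduct l * alternatingTerm n l ≈ (- 1#) ^ l * f (suc n) l
      cancel l = begin
        coeffProduct l * ((- 1#) ^ l * coeffProduct⁻¹ l * f (suc n) l)
          ≈⟨ solve 4 (λ p z i φ → p :* (z :* i :* φ) := z :* (:1 :* i :* p :* φ)) (coeffProduct l) ((- 1#) ^ l) (coeffProduct⁻¹ l) (f (suc n) l) ⟩
        (- 1#) ^ l * (1# * coeffProduct⁻¹ l * coeffProduct l * f (suc n) l)
          ≈⟨ *-congˡ (*-congʳ (÷-* 1# (coeffProduct l) (^*qfact#0 (l C 2) l))) ⟩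
        (- 1#) ^ l * (1# * f (suc n) l)
          ≈⟨ *-congˡ (*-identityˡ _) ⟩
        (- 1#) ^ l * f (suc n) l ∎

    recursionTerm : ℕ → ℕ → ℕ → Carrier
    recursionTerm n s l = (- 1#) ^ (suc (suc s) ∸ l)
      * (coeffProduct (suc s) ÷ (q ^ (l C 2) * qfact l) [ ^*qfact#0 (l C 2) l ]) * f (suc n) l

    -- The sign splits into a part in `s` and a part in `l`, and one `recCoeff s` splits off
    -- `coeffProduct (suc s)`; what remains is the closed form of `crossMean n s`.
    recursion-sum : ∀ n s → ∑[ l ≤ s ] recursionTerm n s (toℕ l) ≈ recCoeff s * crossMean n s
    recursion-sum n s = begin
      ∑[ l ≤ s ] recursionTerm n s (toℕ l)
        ≈⟨ sum-cong-≋ termwise ⟩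
      ∑[ l ≤ s ] (σ * coeffProduct (suc s) * alternatingTerm n (toℕ l))
        -- The bound `l ≤ s` is inclusive, so the sum is `partialSum` at `suc s`.
        ≈⟨ partialSum-* (σ * coeffProduct (suc s)) (alternatingTerm n) (suc s) ⟩
      σ * coeffProduct (suc s) * S
        ≈⟨ *-congʳ (*-congˡ (coeffProduct-suc s)) ⟩
      σ * (recCoeff s * coeffProduct s) * S
        ≈⟨ solve 4 (λ z a p S → z :* (a :* p) :* S := a :* (z :* (p :* S))) σ (recCoeff s) (coeffProduct s) S ⟩
      recCoeff s * (σ * (coeffProduct s * S))
        ≈⟨ *-congˡ (crossMean-sum n s) ⟨
      recCoeff s * crossMean n s ∎
      where
      open MonoidSum +-monoid using (sum-cong-≋)
      σ S : Carrier
      σ = (- 1#) ^ s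
      S = partialSum (alternatingTerm n) (suc s)
      termwise : ∀ (l : Fin (suc s)) → recursionTerm n s (toℕ l) ≈ σ * coeffProduct (suc s) * alternatingTerm n (toℕ l)
      termwise l = trans
        (*-congʳ (*-congʳ (minus-one-∸ (ℕₚ.m≤n⇒m≤1+n (ℕₚ.<⇒≤ (toℕ<n l))))))
        -- `(- 1#) ^ suc (suc s)` unfolds to two factors `- 1#` times `σ`, and these two cancel.
        (solve 5 (λ z y p i φ → (:- :1 :* (:- :1 :* z)) :* y :* (p :* i) :* φ := z :* p :* (y :* i :* φ))
          σ ((- 1#) ^ toℕ l) (coeffProduct (suc s)) (coeffProduct⁻¹ (toℕ l)) (f (suc n) (toℕ l)))

    -- Assembling the recursion.

    recCoeff-square : ∀ s → recCoeff s ^ 2 ≈ q ^ (2 ℕ.* s) * qint (suc s) ^ 2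
    recCoeff-square s = trans (^-distrib-* (q ^ s) (qint (suc s)) 2)
      (*-congʳ (trans (^-assocʳ q s 2) (reflexive (≡.cong (q ^_) (ℕₚ.*-comm s 2)))))

    f-recursion : ∀ n s → f n (suc (suc s)) ≈
      f (suc n) (suc s) - 2 · (∑[ l ≤ s ] recursionTerm n s (toℕ l)) + q ^ (2 ℕ.* s) * qint (suc s) ^ 2 * f n s
    f-recursion n s = trans (f-suc-suc n s) (+-cong (+-congˡ cross) (*-congʳ (recCoeff-square s)))
      where
      cross : - (recCoeff s + recCoeff s) * crossMean n s ≈ - (2 · (∑[ l ≤ s ] recursionTerm n s (toℕ l)))
      -- `2 · t` unfolds to `t + (t + 0#)`, hence the trailing zero.
      cross = trans (solve 2 (λ a y → :- (a :+ a) :* y := :- (a :* y :+ (a :* y :+ :0))) (recCoeff s) (crossMean n s))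
        (-‿cong (+-cong (sym (recursion-sum n s)) (+-congʳ (sym (recursion-sum n s)))))

lemma5p17 : ∀ {c ℓ₁ ℓ₂ ℓ₃} (ℝ : RealField c ℓ₁ ℓ₂ ℓ₃) →
  let open QHermite ℝ in
  (q : Carrier) (0<q : 0# < q) (q<1 : q < 1#) →
  let open Gaussian q 0<q q<1 in
  (∀ n s → 2 ℕ.≤ s →
    f n s ≈
      f (suc n) (s ∸ 1)
      - 2 · (∑[ l ≤ s ∸ 2 ]
               ((- 1#) ^ (s ∸ toℕ l)
                * ((q ^ ((s ∸ 1) C 2) * qfact (s ∸ 1))
                     ÷ (q ^ (toℕ l C 2) * qfact (toℕ l)) [ ^*qfact#0 (toℕ l C 2) (toℕ l) ])
                * f (suc n) (toℕ l)))
      + q ^ (2 ℕ.* (s ∸ 2)) * qint (s ∸ 1) ^ 2 * f n (s ∸ 2))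
  × (∀ n → f n 0 ≈ oddfact n)
  × (∀ n → f n 1 ≈ oddfact (suc n))
-- Matching on the bound turns the index into `suc (suc s)`; subtracting 1 or 2 from it then
-- computes, and the stated summand becomes `recursionTerm` by definition.
lemma5p17 ℝ q 0<q q<1 = (λ { n (suc (suc s)) (ℕ.s≤s (ℕ.s≤s ℕ.z≤n)) → f-recursion n s }) , f-zero , f-one
  where open GaussianMoments.Means ℝ q 0<q q<1
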